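{- (1) $\mathrm{PL}_2(0.7666)$ is false. (2) For any $c>0$, if $\mathrm{PL}_2(0.5+c)$ is true, then any square-difference-free subset of $[N]$ has size at most $N^{1-c+o(1)}$, where $o(1)\to 0$ as $N\to\infty$.
   Context: $[N]=\{1,\dots,N\}$. A set $A\subset\mathbb{Z}$ is square-difference-free if for any distinct $a,a'\in A$ the difference $a-a'$ is not a perfect square. For a point $p$ and a line $\ell$ in $\mathbb{R}^d$, $d_\infty(p,\ell)=\min_{q\in\ell}\|p-q\|_\infty$. For an integer $d\ge 2$ and $0\le\gamma<d$, $\mathrm{PL}_d(\gamma)$ is the following proposition: for every large $n$ and any points $p_1,\dots,p_n\in[0,1]^d$ and lines $\ell_1,\dots,\ell_n$ in $\mathbb{R}^d$ with $p_i\in\ell_i$, there exist $i\ne j$ with $d_\infty(p_i,\ell_j)\le n^{ -\frac{1}{d-\gamma}+o(1)}$. Here $o(1)$ denotes a quantity tending to $0$ as $n\to\infty$, uniformly over all configurations; i.e. for every $\epsilon>0$ there is $n_0$ such that for all $n\ge n_0$ and all such configurations there exist $i\neq j$ with $d_\infty(p_i,\ell_j)\le n^{ -\frac{1}{d-\gamma}+\epsilon}$. -}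

module Defs where

open import Data.Bool.Base using (Bool; true; false; if_then_else_; T)
open import Data.Empty using (⊥-elim)
open import Data.Fin.Base using (Fin; toℕ)
open import Data.Fin.Subset using (Subset; _∈_)
open import Data.Integer.Base as ℤ using (ℤ; +_; -[1+_])
import Data.Integer.Properties as ℤ
import Data.Integer.Solver as ℤSolver
open import Data.Nat.Base as ℕ using (ℕ; zero; suc; NonZero)
import Data.Nat.Properties as ℕ
open import Data.Nat.Tactic.RingSolver using (solve-∀)
open import Data.Product.Base using (∃-syntax; _×_; _,_)
open import Data.Rational.Base as ℚ using (ℚ; 0ℚ; 1ℚ; ½; ↥_; ↧_; ↧ₙ_)
import Data.Rational.Properties as ℚ
import Data.Rational.Solver as ℚSolver
import Data.Rational.Unnormalised.Base as ℚᵘ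
import Data.Rational.Unnormalised.Properties as ℚᵘ
open import Data.Sum.Base using (_⊎_; inj₁; inj₂)
open import Data.Vec.Functional using (Vector; foldr; zipWith)
open import Level using (0ℓ)
open import Relation.Binary.PropositionalEquality
  using (_≡_; _≢_; refl; sym; trans; cong; cong₂; subst; subst₂)
open import Relation.Nullary using (¬_; yes; no)
open import Relation.Nullary.Decidable.Core using (from-yes)
open import Relation.Unary using (Pred)

-- Real numbers are Cauchy sequences of rationals, compared up to _≈ʳ_.

IsCauchy : (ℕ → ℚ) → Set
IsCauchy x = ∀ ε → 0ℚ ℚ.< ε →
  ∃[ N ] (∀ m n → N ℕ.≤ m → N ℕ.≤ n → ℚ.∣ x m ℚ.- x n ∣ ℚ.< ε)

record ℝ : Set where
  constructor mkℝ
  field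
    seq    : ℕ → ℚ
    cauchy : IsCauchy seq

open ℝ public

infix 4 _≈ʳ_ _<ʳ_ _≤ʳ_

_≈ʳ_ : ℝ → ℝ → Set
x ≈ʳ y = ∀ ε → 0ℚ ℚ.< ε →
  ∃[ N ] (∀ n → N ℕ.≤ n → ℚ.∣ seq x n ℚ.- seq y n ∣ ℚ.< ε)

_<ʳ_ : ℝ → ℝ → Set
x <ʳ y = ∃[ ε ] (0ℚ ℚ.< ε × ∃[ N ] (∀ n → N ℕ.≤ n → seq x n ℚ.+ ε ℚ.< seq y n))

_≤ʳ_ : ℝ → ℝ → Set
x ≤ʳ y = ¬ (y <ʳ x)

p≤∣p∣ : ∀ p → p ℚ.≤ ℚ.∣ p ∣
p≤∣p∣ p with ℚ.≤-total 0ℚ p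
... | inj₁ 0≤p = ℚ.≤-reflexive (sym (ℚ.0≤p⇒∣p∣≡p 0≤p))
... | inj₂ p≤0 = ℚ.≤-trans p≤0 (ℚ.0≤∣p∣ p)

∣a-b∣-sym : ∀ a b → ℚ.∣ a ℚ.- b ∣ ≡ ℚ.∣ b ℚ.- a ∣
∣a-b∣-sym a b = trans (sym (ℚ.∣-p∣≡∣p∣ (a ℚ.- b)))
  (cong ℚ.∣_∣ (solve 2 (λ a b → :- (a :- b) := b :- a) refl a b))
  where open ℚSolver.+-*-Solver

a≡b+[a-b] : ∀ a b → a ≡ b ℚ.+ (a ℚ.- b)
a≡b+[a-b] = solve 2 (λ a b → a := b :+ (a :- b)) refl
  where open ℚSolver.+-*-Solver

close⇒< : ∀ {a b ε} → ℚ.∣ a ℚ.- b ∣ ℚ.< ε → a ℚ.< b ℚ.+ ε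
close⇒< {a} {b} {ε} h = begin-strict
  a                     ≡⟨ a≡b+[a-b] a b ⟩
  b ℚ.+ (a ℚ.- b)       ≤⟨ ℚ.+-monoʳ-≤ b (p≤∣p∣ (a ℚ.- b)) ⟩
  b ℚ.+ ℚ.∣ a ℚ.- b ∣   <⟨ ℚ.+-monoʳ-< b h ⟩
  b ℚ.+ ε               ∎
  where open ℚ.≤-Reasoning

a<b+ε⇒a-b<ε : ∀ {a b ε} → a ℚ.< b ℚ.+ ε → a ℚ.- b ℚ.< ε
a<b+ε⇒a-b<ε {a} {b} {ε} h = begin-strict
  a ℚ.- b           <⟨ ℚ.+-monoˡ-< (ℚ.- b) h ⟩
  b ℚ.+ ε ℚ.- b     ≡⟨ solve 2 (λ b ε → b :+ ε :- b := ε) refl b ε ⟩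
  ε                 ∎
  where open ℚ.≤-Reasoning
        open ℚSolver.+-*-Solver

<⇒close : ∀ {a b ε} → a ℚ.< b ℚ.+ ε → b ℚ.< a ℚ.+ ε → ℚ.∣ a ℚ.- b ∣ ℚ.< ε
<⇒close {a} {b} {ε} h h′ with ℚ.∣p∣≡p∨∣p∣≡-p (a ℚ.- b)
... | inj₁ e = subst (ℚ._< ε) (sym e) (a<b+ε⇒a-b<ε h)
... | inj₂ e = subst (ℚ._< ε)
  (trans (solve 2 (λ a b → b :- a := :- (a :- b)) refl a b) (sym e)) (a<b+ε⇒a-b<ε h′)
  where open ℚSolver.+-*-Solver

isCauchy : ∀ x →
  (∀ ε → 0ℚ ℚ.< ε → ∃[ N ] (∀ m n → N ℕ.≤ m → N ℕ.≤ n → x m ℚ.< x n ℚ.+ ε)) →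
  IsCauchy x
isCauchy x h ε 0<ε with h ε 0<ε
... | N , f = N , λ m n N≤m N≤n → <⇒close (f m n N≤m N≤n) (f n m N≤n N≤m)

½ε+½ε≡ε : ∀ ε → ½ ℚ.* ε ℚ.+ ½ ℚ.* ε ≡ ε
½ε+½ε≡ε ε = trans (sym (ℚ.*-distribʳ-+ ε ½ ½)) (ℚ.*-identityˡ ε)

pos* : ∀ {p q} → 0ℚ ℚ.< p → 0ℚ ℚ.< q → 0ℚ ℚ.< p ℚ.* q
pos* {p} {q} 0<p 0<q =
  ℚ.positive⁻¹ _ {{ℚ.pos*pos⇒pos p {{ℚ.positive 0<p}} q {{ℚ.positive 0<q}}}}

0<½ε : ∀ {ε} → 0ℚ ℚ.< ε → 0ℚ ℚ.< ½ ℚ.* ε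
0<½ε = pos* (ℚ.positive⁻¹ ½)

pos-inv : ∀ {p} → 0ℚ ℚ.< p → ∃[ r ] (0ℚ ℚ.< r × p ℚ.* r ≡ 1ℚ)
pos-inv {p} 0<p = (ℚ.1/ p) , ℚ.positive⁻¹ _ {{ℚ.1/pos⇒pos p}} , ℚ.*-inverseʳ p
  where instance
    p-pos = ℚ.positive 0<p
    p-nz  = ℚ.pos⇒nonZero p

eventually-bounded : (x : ℝ) →
  ∃[ K ] (0ℚ ℚ.< K × ∃[ N ] (∀ n → N ℕ.≤ n → ℚ.∣ seq x n ∣ ℚ.≤ K))
eventually-bounded x with cauchy x 1ℚ (ℚ.positive⁻¹ 1ℚ)
... | N , f = K , 0<K , N , bound
  where
  K = ℚ.∣ seq x N ∣ ℚ.+ 1ℚ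
  0<K : 0ℚ ℚ.< K
  0<K = ℚ.+-mono-≤-< (ℚ.0≤∣p∣ (seq x N)) (ℚ.positive⁻¹ 1ℚ)
  bound : ∀ n → N ℕ.≤ n → ℚ.∣ seq x n ∣ ℚ.≤ K
  bound n N≤n = begin
    ℚ.∣ a ∣                     ≡⟨ cong ℚ.∣_∣ (a≡b+[a-b] a b) ⟩
    ℚ.∣ b ℚ.+ (a ℚ.- b) ∣       ≤⟨ ℚ.∣p+q∣≤∣p∣+∣q∣ b (a ℚ.- b) ⟩
    ℚ.∣ b ∣ ℚ.+ ℚ.∣ a ℚ.- b ∣   ≤⟨ ℚ.+-monoʳ-≤ ℚ.∣ b ∣ (ℚ.<⇒≤ (f n N N≤n ℕ.≤-refl)) ⟩
    ℚ.∣ b ∣ ℚ.+ 1ℚ              ∎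
    where
    open ℚ.≤-Reasoning
    a = seq x n
    b = seq x N

abstract
  fromℚ-cauchy : ∀ q → IsCauchy (λ _ → q)
  fromℚ-cauchy q ε 0<ε = 0 , λ _ _ _ _ →
    subst (ℚ._< ε) (cong ℚ.∣_∣ (sym (ℚ.+-inverseʳ q))) 0<ε

fromℚ : ℚ → ℝ
fromℚ q = mkℝ (λ _ → q) (fromℚ-cauchy q)

fromℕ : ℕ → ℝ
fromℕ n = fromℚ (+ n ℚ./ 1)

0ʳ 1ʳ : ℝ
0ʳ = fromℚ 0ℚ
1ʳ = fromℚ 1ℚ

infixl 6 _+ʳ_ _-ʳ_ _⊔ʳ_
infixl 7 _*ʳ_
infix  8 -ʳ_

abstract
  +ʳ-cauchy : ∀ x y → IsCauchy (λ n → seq x n ℚ.+ seq y n)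
  +ʳ-cauchy x y = λ ε 0<ε →
    let Nx , fx = cauchy x (½ ℚ.* ε) (0<½ε 0<ε)
        Ny , fy = cauchy y (½ ℚ.* ε) (0<½ε 0<ε)
    in Nx ℕ.⊔ Ny , λ m n N≤m N≤n →
       close (seq x m) (seq x n) (seq y m) (seq y n)
         (fx m n (ℕ.m⊔n≤o⇒m≤o Nx Ny N≤m) (ℕ.m⊔n≤o⇒m≤o Nx Ny N≤n))
         (fy m n (ℕ.m⊔n≤o⇒n≤o Nx Ny N≤m) (ℕ.m⊔n≤o⇒n≤o Nx Ny N≤n))
    where
    close : ∀ {ε} a c b d → ℚ.∣ a ℚ.- c ∣ ℚ.< ½ ℚ.* ε → ℚ.∣ b ℚ.- d ∣ ℚ.< ½ ℚ.* ε →
            ℚ.∣ (a ℚ.+ b) ℚ.- (c ℚ.+ d) ∣ ℚ.< ε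
    close {ε} a c b d h h′ = begin-strict
      ℚ.∣ (a ℚ.+ b) ℚ.- (c ℚ.+ d) ∣
        ≡⟨ cong ℚ.∣_∣ (solve 4 (λ a b c d → (a :+ b) :- (c :+ d) := (a :- c) :+ (b :- d)) refl a b c d) ⟩
      ℚ.∣ (a ℚ.- c) ℚ.+ (b ℚ.- d) ∣       ≤⟨ ℚ.∣p+q∣≤∣p∣+∣q∣ (a ℚ.- c) (b ℚ.- d) ⟩
      ℚ.∣ a ℚ.- c ∣ ℚ.+ ℚ.∣ b ℚ.- d ∣     <⟨ ℚ.+-mono-< h h′ ⟩
      ½ ℚ.* ε ℚ.+ ½ ℚ.* ε                 ≡⟨ ½ε+½ε≡ε ε ⟩
      ε                                   ∎
      where open ℚ.≤-Reasoning
            open ℚSolver.+-*-Solver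

_+ʳ_ : ℝ → ℝ → ℝ
x +ʳ y = mkℝ (λ n → seq x n ℚ.+ seq y n) (+ʳ-cauchy x y)

abstract
  -ʳ-cauchy : ∀ x → IsCauchy (λ n → ℚ.- seq x n)
  -ʳ-cauchy x = λ ε 0<ε →
    let N , f = cauchy x ε 0<ε
    in N , λ m n N≤m N≤n → subst (ℚ._< ε) (eq (seq x m) (seq x n)) (f m n N≤m N≤n)
    where
    eq : ∀ a b → ℚ.∣ a ℚ.- b ∣ ≡ ℚ.∣ ℚ.- a ℚ.- (ℚ.- b) ∣
    eq a b = trans (∣a-b∣-sym a b)
      (cong ℚ.∣_∣ (solve 2 (λ a b → b :- a := :- a :- (:- b)) refl a b))
      where open ℚSolver.+-*-Solver

-ʳ_ : ℝ → ℝ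
-ʳ x = mkℝ (λ n → ℚ.- seq x n) (-ʳ-cauchy x)

_-ʳ_ : ℝ → ℝ → ℝ
x -ʳ y = x +ʳ -ʳ y

abstract
  *ʳ-cauchy : ∀ x y → IsCauchy (λ n → seq x n ℚ.* seq y n)
  *ʳ-cauchy x y = λ ε 0<ε →
    let Kx , 0<Kx , Mx , bx = eventually-bounded x
        Ky , 0<Ky , My , by = eventually-bounded y
        K = Kx ℚ.+ Ky
        0<K = ℚ.+-mono-< 0<Kx 0<Ky
        Kx≤K = ℚ.≤-trans (ℚ.≤-reflexive (sym (ℚ.+-identityʳ Kx))) (ℚ.+-monoʳ-≤ Kx (ℚ.<⇒≤ 0<Ky))
        Ky≤K = ℚ.≤-trans (ℚ.≤-reflexive (sym (ℚ.+-identityˡ Ky))) (ℚ.+-monoˡ-≤ Ky (ℚ.<⇒≤ 0<Kx))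
        r , 0<r , Kr≡1 = pos-inv 0<K
        η = r ℚ.* (½ ℚ.* ε)
        0<η = pos* 0<r (0<½ε 0<ε)
        Nx , fx = cauchy x η 0<η
        Ny , fy = cauchy y η 0<η
        N = (Nx ℕ.⊔ Ny) ℕ.⊔ (Mx ℕ.⊔ My)
        toNx = λ {m} (h : N ℕ.≤ m) → ℕ.m⊔n≤o⇒m≤o Nx Ny (ℕ.m⊔n≤o⇒m≤o (Nx ℕ.⊔ Ny) (Mx ℕ.⊔ My) h)
        toNy = λ {m} (h : N ℕ.≤ m) → ℕ.m⊔n≤o⇒n≤o Nx Ny (ℕ.m⊔n≤o⇒m≤o (Nx ℕ.⊔ Ny) (Mx ℕ.⊔ My) h)
        toMx = λ {m} (h : N ℕ.≤ m) → ℕ.m⊔n≤o⇒m≤o Mx My (ℕ.m⊔n≤o⇒n≤o (Nx ℕ.⊔ Ny) (Mx ℕ.⊔ My) h)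
        toMy = λ {m} (h : N ℕ.≤ m) → ℕ.m⊔n≤o⇒n≤o Mx My (ℕ.m⊔n≤o⇒n≤o (Nx ℕ.⊔ Ny) (Mx ℕ.⊔ My) h)
    in N , λ m n N≤m N≤n →
       close K r (seq x m) (seq x n) (seq y m) (seq y n) 0<K Kr≡1
         (fx m n (toNx N≤m) (toNx N≤n)) (fy m n (toNy N≤m) (toNy N≤n))
         (ℚ.≤-trans (bx n (toMx N≤n)) Kx≤K) (ℚ.≤-trans (by m (toMy N≤m)) Ky≤K)
    where
    close : ∀ {ε} K r a c b d → 0ℚ ℚ.< K → K ℚ.* r ≡ 1ℚ →
            ℚ.∣ a ℚ.- c ∣ ℚ.< r ℚ.* (½ ℚ.* ε) → ℚ.∣ b ℚ.- d ∣ ℚ.< r ℚ.* (½ ℚ.* ε) →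
            ℚ.∣ c ∣ ℚ.≤ K → ℚ.∣ b ∣ ℚ.≤ K →
            ℚ.∣ a ℚ.* b ℚ.- c ℚ.* d ∣ ℚ.< ε
    close {ε} K r a c b d 0<K Kr≡1 h h′ c≤K b≤K = begin-strict
      ℚ.∣ a ℚ.* b ℚ.- c ℚ.* d ∣
        ≡⟨ cong ℚ.∣_∣ (solve 4 (λ a b c d → a :* b :- c :* d := b :* (a :- c) :+ c :* (b :- d)) refl a b c d) ⟩
      ℚ.∣ b ℚ.* (a ℚ.- c) ℚ.+ c ℚ.* (b ℚ.- d) ∣
        ≤⟨ ℚ.∣p+q∣≤∣p∣+∣q∣ (b ℚ.* (a ℚ.- c)) (c ℚ.* (b ℚ.- d)) ⟩
      ℚ.∣ b ℚ.* (a ℚ.- c) ∣ ℚ.+ ℚ.∣ c ℚ.* (b ℚ.- d) ∣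
        ≤⟨ ℚ.+-mono-≤ (part b (a ℚ.- c) b≤K) (part c (b ℚ.- d) c≤K) ⟩
      K ℚ.* ℚ.∣ a ℚ.- c ∣ ℚ.+ K ℚ.* ℚ.∣ b ℚ.- d ∣
        <⟨ ℚ.+-mono-< (scale h) (scale h′) ⟩
      ½ ℚ.* ε ℚ.+ ½ ℚ.* ε
        ≡⟨ ½ε+½ε≡ε ε ⟩
      ε ∎
      where
      open ℚ.≤-Reasoning
      open ℚSolver.+-*-Solver
      part : ∀ u v → ℚ.∣ u ∣ ℚ.≤ K → ℚ.∣ u ℚ.* v ∣ ℚ.≤ K ℚ.* ℚ.∣ v ∣
      part u v u≤K = ℚ.≤-trans (ℚ.≤-reflexive (ℚ.∣p*q∣≡∣p∣*∣q∣ u v))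
        (ℚ.*-monoʳ-≤-nonNeg ℚ.∣ v ∣ {{ℚ.∣-∣-nonNeg v}} u≤K)
      scale : ∀ {u} → u ℚ.< r ℚ.* (½ ℚ.* ε) → K ℚ.* u ℚ.< ½ ℚ.* ε
      scale {u} u< = begin-strict
        K ℚ.* u                   <⟨ ℚ.*-monoʳ-<-pos K {{ℚ.positive 0<K}} u< ⟩
        K ℚ.* (r ℚ.* (½ ℚ.* ε))   ≡⟨ sym (ℚ.*-assoc K r (½ ℚ.* ε)) ⟩
        K ℚ.* r ℚ.* (½ ℚ.* ε)     ≡⟨ cong (ℚ._* (½ ℚ.* ε)) Kr≡1 ⟩
        1ℚ ℚ.* (½ ℚ.* ε)          ≡⟨ ℚ.*-identityˡ (½ ℚ.* ε) ⟩
        ½ ℚ.* ε                   ∎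

_*ʳ_ : ℝ → ℝ → ℝ
x *ʳ y = mkℝ (λ n → seq x n ℚ.* seq y n) (*ʳ-cauchy x y)

abstract
  ⊔ʳ-cauchy : ∀ x y → IsCauchy (λ n → seq x n ℚ.⊔ seq y n)
  ⊔ʳ-cauchy x y = isCauchy _ λ ε 0<ε →
    let Nx , fx = cauchy x ε 0<ε
        Ny , fy = cauchy y ε 0<ε
    in Nx ℕ.⊔ Ny , λ m n N≤m N≤n →
       close (seq x m) (seq x n) (seq y m) (seq y n)
         (close⇒< (fx m n (ℕ.m⊔n≤o⇒m≤o Nx Ny N≤m) (ℕ.m⊔n≤o⇒m≤o Nx Ny N≤n)))
         (close⇒< (fy m n (ℕ.m⊔n≤o⇒n≤o Nx Ny N≤m) (ℕ.m⊔n≤o⇒n≤o Nx Ny N≤n)))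
    where
    close : ∀ {ε} a c b d → a ℚ.< c ℚ.+ ε → b ℚ.< d ℚ.+ ε → a ℚ.⊔ b ℚ.< (c ℚ.⊔ d) ℚ.+ ε
    close {ε} a c b d h h′ with ℚ.⊔-sel a b
    ... | inj₁ e = ℚ.<-respˡ-≡ (sym e)
      (ℚ.<-≤-trans h (ℚ.+-monoˡ-≤ ε (ℚ.p≤p⊔q c d)))
    ... | inj₂ e = ℚ.<-respˡ-≡ (sym e)
      (ℚ.<-≤-trans h′ (ℚ.+-monoˡ-≤ ε (ℚ.p≤q⊔p c d)))

_⊔ʳ_ : ℝ → ℝ → ℝ
x ⊔ʳ y = mkℝ (λ n → seq x n ℚ.⊔ seq y n) (⊔ʳ-cauchy x y)

∣_∣ʳ : ℝ → ℝ
∣ x ∣ʳ = x ⊔ʳ (-ʳ x)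

1/-close : ∀ δ a b i j ε → 0ℚ ℚ.< δ → δ ℚ.≤ a → δ ℚ.≤ b → 0ℚ ℚ.< i → 0ℚ ℚ.< j → 0ℚ ℚ.< ε →
  i ℚ.* a ≡ 1ℚ → j ℚ.* b ≡ 1ℚ → ℚ.∣ b ℚ.- a ∣ ℚ.< ε ℚ.* (δ ℚ.* δ) → ℚ.∣ i ℚ.- j ∣ ℚ.< ε
1/-close δ a b i j ε 0<δ δ≤a δ≤b 0<i 0<j 0<ε ia≡1 jb≡1 h = begin-strict
  ℚ.∣ i ℚ.- j ∣
    ≡⟨ cong ℚ.∣_∣ i-j ⟩
  ℚ.∣ (i ℚ.* j) ℚ.* (b ℚ.- a) ∣
    ≡⟨ ℚ.∣p*q∣≡∣p∣*∣q∣ (i ℚ.* j) (b ℚ.- a) ⟩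
  ℚ.∣ i ℚ.* j ∣ ℚ.* ℚ.∣ b ℚ.- a ∣
    ≡⟨ cong (ℚ._* ℚ.∣ b ℚ.- a ∣) (ℚ.0≤p⇒∣p∣≡p (ℚ.<⇒≤ (pos* 0<i 0<j))) ⟩
  (i ℚ.* j) ℚ.* ℚ.∣ b ℚ.- a ∣
    <⟨ ℚ.*-monoʳ-<-pos (i ℚ.* j) {{ℚ.positive (pos* 0<i 0<j)}} h ⟩
  (i ℚ.* j) ℚ.* (ε ℚ.* (δ ℚ.* δ))
    ≡⟨ solve 4 (λ i j ε δ → (i :* j) :* (ε :* (δ :* δ)) := ε :* (i :* δ) :* (j :* δ)) refl i j ε δ ⟩
  ε ℚ.* (i ℚ.* δ) ℚ.* (j ℚ.* δ)
    ≤⟨ below1 (ε ℚ.* (i ℚ.* δ)) (pos* 0<ε (pos* 0<i 0<δ)) j b 0<j δ≤b jb≡1 ⟩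
  ε ℚ.* (i ℚ.* δ)
    ≤⟨ below1 ε 0<ε i a 0<i δ≤a ia≡1 ⟩
  ε ∎
  where
  open ℚ.≤-Reasoning
  open ℚSolver.+-*-Solver
  below1 : ∀ c → 0ℚ ℚ.< c → ∀ k e → 0ℚ ℚ.< k → δ ℚ.≤ e → k ℚ.* e ≡ 1ℚ → c ℚ.* (k ℚ.* δ) ℚ.≤ c
  below1 c 0<c k e 0<k δ≤e ke≡1 = begin
    c ℚ.* (k ℚ.* δ)
      ≤⟨ ℚ.*-monoˡ-≤-nonNeg c {{ℚ.nonNegative (ℚ.<⇒≤ 0<c)}}
           (ℚ.*-monoˡ-≤-nonNeg k {{ℚ.nonNegative (ℚ.<⇒≤ 0<k)}} δ≤e) ⟩
    c ℚ.* (k ℚ.* e)   ≡⟨ cong (c ℚ.*_) ke≡1 ⟩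
    c ℚ.* 1ℚ          ≡⟨ ℚ.*-identityʳ c ⟩
    c                 ∎
  i-j : i ℚ.- j ≡ (i ℚ.* j) ℚ.* (b ℚ.- a)
  i-j = sym (trans
    (solve 4 (λ i j a b → (i :* j) :* (b :- a) := i :* (j :* b) :- j :* (i :* a)) refl i j a b)
    (cong₂ ℚ._-_
      (trans (cong (i ℚ.*_) jb≡1) (ℚ.*-identityʳ i))
      (trans (cong (j ℚ.*_) ia≡1) (ℚ.*-identityʳ j))))

-- If δ is an eventual positive lower bound of x, then δ ⊔ xₙ is positive for
-- every n and equals xₙ for all large n.
module Recip (x : ℝ) (δ : ℚ) (0<δ : 0ℚ ℚ.< δ) where
  den : ℕ → ℚ
  den n = δ ℚ.⊔ seq x n

  den-pos : ∀ n → ℚ.Positive (den n)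
  den-pos n = ℚ.positive (ℚ.<-≤-trans 0<δ (ℚ.p≤p⊔q δ (seq x n)))

  den-nonZero : ∀ n → ℚ.NonZero (den n)
  den-nonZero n = ℚ.pos⇒nonZero (den n) {{den-pos n}}

  inv : ℕ → ℚ
  inv n = ℚ.1/_ (den n) {{den-nonZero n}}

  inv-pos : ∀ n → 0ℚ ℚ.< inv n
  inv-pos n = ℚ.positive⁻¹ (inv n) {{ℚ.1/pos⇒pos (den n) {{den-pos n}}}}

  den-close : ∀ p q η → 0ℚ ℚ.< η → p ℚ.< q ℚ.+ η → δ ℚ.⊔ p ℚ.< (δ ℚ.⊔ q) ℚ.+ η
  den-close p q η 0<η p< with ℚ.⊔-sel δ p
  ... | inj₁ e = ℚ.<-respˡ-≡ (sym e) (ℚ.≤-<-trans (ℚ.p≤p⊔q δ q)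
    (ℚ.<-respˡ-≡ (ℚ.+-identityʳ (δ ℚ.⊔ q)) (ℚ.+-monoʳ-< (δ ℚ.⊔ q) 0<η)))
  ... | inj₂ e = ℚ.<-respˡ-≡ (sym e) (ℚ.<-≤-trans p< (ℚ.+-monoˡ-≤ η (ℚ.p≤q⊔p δ q)))

  abstract
    inv-cauchy : IsCauchy inv
    inv-cauchy ε 0<ε =
      let η = ε ℚ.* (δ ℚ.* δ)
          0<η = pos* 0<ε (pos* 0<δ 0<δ)
          N , f = cauchy x η 0<η
      in N , λ m n N≤m N≤n →
         1/-close δ (den m) (den n) (inv m) (inv n) ε 0<δ
           (ℚ.p≤p⊔q δ (seq x m)) (ℚ.p≤p⊔q δ (seq x n)) (inv-pos m) (inv-pos n) 0<ε
           (ℚ.*-inverseˡ (den m) {{den-nonZero m}}) (ℚ.*-inverseˡ (den n) {{den-nonZero n}})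
           (<⇒close (den-close (seq x n) (seq x m) η 0<η (close⇒< (f n m N≤n N≤m)))
                    (den-close (seq x m) (seq x n) η 0<η (close⇒< (f m n N≤m N≤n))))

recip : (x : ℝ) → 0ʳ <ʳ x → ℝ
recip x (δ , 0<δ , _) = mkℝ inv inv-cauchy
  where open Recip x δ 0<δ

x<y⇒0<y-x : ∀ {x y} → x <ʳ y → 0ʳ <ʳ y -ʳ x
x<y⇒0<y-x {x} {y} (ε , 0<ε , N , f) = ε , 0<ε , N , λ n N≤n → lem (seq x n) (seq y n) (f n N≤n)
  where
  lem : ∀ a b → a ℚ.+ ε ℚ.< b → 0ℚ ℚ.+ ε ℚ.< b ℚ.- a
  lem a b h = subst (ℚ._< b ℚ.- a)
    (solve 2 (λ a ε → a :+ ε :- a := con 0ℚ :+ ε) refl a ε) (ℚ.+-monoˡ-< (ℚ.- a) h)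
    where open ℚSolver.+-*-Solver

fromℚ-mono-< : ∀ {p q} → p ℚ.< q → fromℚ p <ʳ fromℚ q
fromℚ-mono-< {p} {q} p<q =
  ε , 0<½ε (a<b⇒0<b-a p<q) , 0 , λ _ _ → lem
  where
  open ℚSolver.+-*-Solver
  ε = ½ ℚ.* (q ℚ.- p)
  a<b⇒0<b-a : ∀ {a b} → a ℚ.< b → 0ℚ ℚ.< b ℚ.- a
  a<b⇒0<b-a {a} h = ℚ.<-respˡ-≡ (ℚ.+-inverseʳ a) (ℚ.+-monoˡ-< (ℚ.- a) h)
  0<ε : 0ℚ ℚ.< ε
  0<ε = 0<½ε (a<b⇒0<b-a p<q)
  lem : p ℚ.+ ε ℚ.< q
  lem = begin-strict
    p ℚ.+ ε             ≡⟨ sym (ℚ.+-identityʳ (p ℚ.+ ε)) ⟩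
    p ℚ.+ ε ℚ.+ 0ℚ      <⟨ ℚ.+-monoʳ-< (p ℚ.+ ε) 0<ε ⟩
    p ℚ.+ ε ℚ.+ ε       ≡⟨ ℚ.+-assoc p ε ε ⟩
    p ℚ.+ (ε ℚ.+ ε)     ≡⟨ cong (p ℚ.+_) (½ε+½ε≡ε (q ℚ.- p)) ⟩
    p ℚ.+ (q ℚ.- p)     ≡⟨ sym (a≡b+[a-b] q p) ⟩
    q                   ∎
    where open ℚ.≤-Reasoning

-- Real powers of positive natural numbers: b ^ x is the limit of
-- ⌊(k + 1) b ^ xₖ⌋ / (k + 1), where xₖ is the k-th rational approximation of x.

posPart negPart : ℤ → ℕ
posPart (+ n)    = n
posPart -[1+ n ] = 0
negPart i = posPart (ℤ.- i)

-- m / k ≤ b ^ r, cleared of denominators and negative exponents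
powTest : (b : ℕ) (r : ℚ) (k m : ℕ) → Bool
powTest b r k m =
  m ℕ.^ ↧ₙ r ℕ.* b ℕ.^ negPart (↥ r) ℕ.≤ᵇ b ℕ.^ posPart (↥ r) ℕ.* k ℕ.^ ↧ₙ r

greatest : (ℕ → Bool) → ℕ → ℕ
greatest P zero    = zero
greatest P (suc n) = if P (suc n) then suc n else greatest P n

-- The floor of k * b ^ r.
powFloor : (b : ℕ) (r : ℚ) (k : ℕ) → ℕ
powFloor b r k = greatest (powTest b r k) (b ℕ.^ posPart (↥ r) ℕ.* k)

module PowFloor where
  greatest-holds : ∀ (P : ℕ → Bool) n → T (P 0) → T (P (greatest P n))
  greatest-holds P zero    h = h
  greatest-holds P (suc n) h with P (suc n) in e
  ... | true  = subst T (sym e) _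
  ... | false = greatest-holds P n h

  greatest-max : ∀ (P : ℕ → Bool) n → ¬ T (P (suc n)) → ¬ T (P (suc (greatest P n)))
  greatest-max P zero    h = h
  greatest-max P (suc n) h with P (suc n) in e
  ... | true  = h
  ... | false = greatest-max P n (subst T e)

  ^-distribʳ-* : ∀ m n o → (m ℕ.* n) ℕ.^ o ≡ m ℕ.^ o ℕ.* n ℕ.^ o
  ^-distribʳ-* m n zero    = refl
  ^-distribʳ-* m n (suc o) = trans (cong (m ℕ.* n ℕ.*_) (^-distribʳ-* m n o))
    (shuffle m n (m ℕ.^ o) (n ℕ.^ o))
    where
    shuffle : ∀ a b c d → a ℕ.* b ℕ.* (c ℕ.* d) ≡ a ℕ.* c ℕ.* (b ℕ.* d)
    shuffle = solve-∀

  ^-cancelˡ-≤ : ∀ n .{{_ : NonZero n}} {a c} → a ℕ.^ n ℕ.≤ c ℕ.^ n → a ℕ.≤ c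
  ^-cancelˡ-≤ n {a} {c} h with a ℕ.≤? c
  ... | yes a≤c = a≤c
  ... | no  a≰c = ⊥-elim (ℕ.<⇒≱ (ℕ.^-monoˡ-< n (ℕ.≰⇒> a≰c)) h)

  -- Bernoulli's inequality (1 + b / J) ^ n ≥ 1 + n b / J
  bernoulli : ∀ J b n → J ℕ.^ n ℕ.* (J ℕ.+ n ℕ.* b) ℕ.≤ (J ℕ.+ b) ℕ.^ n ℕ.* J
  bernoulli J b zero    = ℕ.≤-reflexive (eq J)
    where
    eq : ∀ J → 1 ℕ.* (J ℕ.+ 0) ≡ 1 ℕ.* J
    eq = solve-∀
  bernoulli J b (suc n) = begin
    J ℕ.^ suc n ℕ.* (J ℕ.+ suc n ℕ.* b)
      ≤⟨ ℕ.m≤m+n _ (J ℕ.^ n ℕ.* (n ℕ.* b ℕ.* b)) ⟩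
    J ℕ.^ suc n ℕ.* (J ℕ.+ suc n ℕ.* b) ℕ.+ J ℕ.^ n ℕ.* (n ℕ.* b ℕ.* b)
      ≡⟨ eq₁ J b n (J ℕ.^ n) ⟩
    (J ℕ.+ b) ℕ.* (J ℕ.^ n ℕ.* (J ℕ.+ n ℕ.* b))
      ≤⟨ ℕ.*-monoʳ-≤ (J ℕ.+ b) (bernoulli J b n) ⟩
    (J ℕ.+ b) ℕ.* ((J ℕ.+ b) ℕ.^ n ℕ.* J)
      ≡⟨ sym (ℕ.*-assoc (J ℕ.+ b) ((J ℕ.+ b) ℕ.^ n) J) ⟩
    (J ℕ.+ b) ℕ.^ suc n ℕ.* J ∎
    where
    open ℕ.≤-Reasoning
    eq₁ : ∀ J b n P → J ℕ.* P ℕ.* (J ℕ.+ (b ℕ.+ n ℕ.* b)) ℕ.+ P ℕ.* (n ℕ.* b ℕ.* b)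
        ≡ (J ℕ.+ b) ℕ.* (P ℕ.* (J ℕ.+ n ℕ.* b))
    eq₁ = solve-∀

  b*J^J≤[J+b]^J : ∀ J .{{_ : NonZero J}} b → b ℕ.* J ℕ.^ J ℕ.≤ (J ℕ.+ b) ℕ.^ J
  b*J^J≤[J+b]^J J b = ℕ.*-cancelʳ-≤ _ _ J (begin
    b ℕ.* J ℕ.^ J ℕ.* J               ≤⟨ ℕ.m≤n+m _ (J ℕ.^ J ℕ.* J) ⟩
    J ℕ.^ J ℕ.* J ℕ.+ b ℕ.* J ℕ.^ J ℕ.* J   ≡⟨ eq (J ℕ.^ J) J b ⟩
    J ℕ.^ J ℕ.* (J ℕ.+ J ℕ.* b)       ≤⟨ bernoulli J b J ⟩
    (J ℕ.+ b) ℕ.^ J ℕ.* J             ∎)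
    where
    open ℕ.≤-Reasoning
    eq : ∀ P J b → P ℕ.* J ℕ.+ b ℕ.* P ℕ.* J ≡ P ℕ.* (J ℕ.+ J ℕ.* b)
    eq = solve-∀

  -- r ≤ s + 1 / J, cleared of denominators
  Near : ℚ → ℚ → ℕ → Set
  Near r s J =
    posPart (↥ r) ℕ.* (↧ₙ s ℕ.* J) ℕ.+ negPart (↥ s) ℕ.* (↧ₙ r ℕ.* J)
      ℕ.≤ posPart (↥ s) ℕ.* (↧ₙ r ℕ.* J) ℕ.+ ↧ₙ r ℕ.* ↧ₙ s ℕ.+ negPart (↥ r) ℕ.* (↧ₙ s ℕ.* J)

  module _ (b : ℕ) .{{_ : NonZero b}} where
    floor-lower : ∀ r k .{{_ : NonZero k}} →
      powFloor b r k ℕ.^ ↧ₙ r ℕ.* b ℕ.^ negPart (↥ r) ℕ.≤ b ℕ.^ posPart (↥ r) ℕ.* k ℕ.^ ↧ₙ r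
    floor-lower r@record{} k = ℕ.≤ᵇ⇒≤ _ _ (greatest-holds (powTest b r k) (b ℕ.^ posPart (↥ r) ℕ.* k) _)

    floor-upper : ∀ r k .{{_ : NonZero k}} →
      b ℕ.^ posPart (↥ r) ℕ.* k ℕ.^ ↧ₙ r ℕ.< suc (powFloor b r k) ℕ.^ ↧ₙ r ℕ.* b ℕ.^ negPart (↥ r)
    floor-upper r@record{} k = ℕ.≰⇒> λ h →
      greatest-max (powTest b r k) M (λ t → ℕ.<⇒≱ big (ℕ.≤ᵇ⇒≤ _ _ t)) (ℕ.≤⇒≤ᵇ h)
      where
      p = posPart (↥ r)
      q = ↧ₙ r
      M = b ℕ.^ p ℕ.* k
      b^n≢0 : ∀ n → NonZero (b ℕ.^ n)
      b^n≢0 n = ℕ.m^n≢0 b n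
      big : b ℕ.^ p ℕ.* k ℕ.^ q ℕ.< suc M ℕ.^ q ℕ.* b ℕ.^ negPart (↥ r)
      big = begin-strict
        b ℕ.^ p ℕ.* k ℕ.^ q             ≤⟨ ℕ.*-monoˡ-≤ (k ℕ.^ q) (ℕ.m≤m*n (b ℕ.^ p) ((b ℕ.^ p) ℕ.^ (q ℕ.∸ 1)) {{ℕ.m^n≢0 (b ℕ.^ p) (q ℕ.∸ 1) {{b^n≢0 p}}}}) ⟩
        (b ℕ.^ p) ℕ.^ q ℕ.* k ℕ.^ q     ≡⟨ sym (^-distribʳ-* (b ℕ.^ p) k q) ⟩
        M ℕ.^ q                         <⟨ ℕ.^-monoˡ-< q (ℕ.n<1+n M) ⟩
        suc M ℕ.^ q                     ≤⟨ ℕ.m≤m*n (suc M ℕ.^ q) (b ℕ.^ negPart (↥ r)) {{b^n≢0 (negPart (↥ r))}} ⟩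
        suc M ℕ.^ q ℕ.* b ℕ.^ negPart (↥ r) ∎
        where open ℕ.≤-Reasoning

    -- b ^ r ≤ b ^ s * (1 + b / J) up to rounding, since (1 + b / J) ^ J ≥ b
    step : ∀ r s k l J .{{_ : NonZero k}} .{{_ : NonZero l}} .{{_ : NonZero J}} → Near r s J →
      powFloor b r k ℕ.* (l ℕ.* J) ℕ.≤ suc (powFloor b s l) ℕ.* (k ℕ.* (J ℕ.+ b))
    step r@record{} s@record{} k l J near = ^-cancelˡ-≤ E (ℕ.*-cancelʳ-≤ _ _ (b ℕ.^ V) (begin
      (m ℕ.* (l ℕ.* J)) ℕ.^ E ℕ.* b ℕ.^ V
        ≡⟨ cong (ℕ._* b ℕ.^ V) (split m l J) ⟩
      m ℕ.^ E ℕ.* (l ℕ.^ E ℕ.* J ℕ.^ E) ℕ.* b ℕ.^ V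
        ≡⟨ cong (m ℕ.^ E ℕ.* (l ℕ.^ E ℕ.* J ℕ.^ E) ℕ.*_) V-split ⟩
      m ℕ.^ E ℕ.* (l ℕ.^ E ℕ.* J ℕ.^ E) ℕ.* (b ℕ.^ (s⁺ ℕ.* (q ℕ.* J)) ℕ.* b ℕ.^ (q ℕ.* t) ℕ.* b ℕ.^ (r⁻ ℕ.* (t ℕ.* J)))
        ≡⟨ shuffle₁ (m ℕ.^ E) (l ℕ.^ E) (J ℕ.^ E) (b ℕ.^ (s⁺ ℕ.* (q ℕ.* J))) (b ℕ.^ (q ℕ.* t)) (b ℕ.^ (r⁻ ℕ.* (t ℕ.* J))) ⟩
      (m ℕ.^ E ℕ.* b ℕ.^ (r⁻ ℕ.* (t ℕ.* J))) ℕ.* ((b ℕ.^ (s⁺ ℕ.* (q ℕ.* J)) ℕ.* l ℕ.^ E) ℕ.* (b ℕ.^ (q ℕ.* t) ℕ.* J ℕ.^ E))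
        ≤⟨ ℕ.*-mono-≤ low (ℕ.*-mono-≤ up bern) ⟩
      (b ℕ.^ (r⁺ ℕ.* (t ℕ.* J)) ℕ.* k ℕ.^ E) ℕ.* ((m′ ℕ.^ E ℕ.* b ℕ.^ (s⁻ ℕ.* (q ℕ.* J))) ℕ.* (J ℕ.+ b) ℕ.^ E)
        ≡⟨ shuffle₂ (b ℕ.^ (r⁺ ℕ.* (t ℕ.* J))) (k ℕ.^ E) (m′ ℕ.^ E) (b ℕ.^ (s⁻ ℕ.* (q ℕ.* J))) ((J ℕ.+ b) ℕ.^ E) ⟩
      m′ ℕ.^ E ℕ.* (k ℕ.^ E ℕ.* (J ℕ.+ b) ℕ.^ E) ℕ.* (b ℕ.^ (r⁺ ℕ.* (t ℕ.* J)) ℕ.* b ℕ.^ (s⁻ ℕ.* (q ℕ.* J)))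
        ≡⟨ cong₂ ℕ._*_ (sym (split m′ k (J ℕ.+ b))) (sym (ℕ.^-distribˡ-+-* b (r⁺ ℕ.* (t ℕ.* J)) (s⁻ ℕ.* (q ℕ.* J)))) ⟩
      (m′ ℕ.* (k ℕ.* (J ℕ.+ b))) ℕ.^ E ℕ.* b ℕ.^ (r⁺ ℕ.* (t ℕ.* J) ℕ.+ s⁻ ℕ.* (q ℕ.* J))
        ≤⟨ ℕ.*-monoʳ-≤ ((m′ ℕ.* (k ℕ.* (J ℕ.+ b))) ℕ.^ E) (ℕ.^-monoʳ-≤ b near) ⟩
      (m′ ℕ.* (k ℕ.* (J ℕ.+ b))) ℕ.^ E ℕ.* b ℕ.^ V ∎))
      where
      open ℕ.≤-Reasoning
      q = ↧ₙ r
      t = ↧ₙ s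
      r⁺ = posPart (↥ r)
      r⁻ = negPart (↥ r)
      s⁺ = posPart (↥ s)
      s⁻ = negPart (↥ s)
      m = powFloor b r k
      m′ = suc (powFloor b s l)
      E = q ℕ.* (t ℕ.* J)
      V = s⁺ ℕ.* (q ℕ.* J) ℕ.+ q ℕ.* t ℕ.+ r⁻ ℕ.* (t ℕ.* J)
      instance
        tJ≢0 : NonZero (t ℕ.* J)
        tJ≢0 = ℕ.m*n≢0 t J
        E≢0 : NonZero E
        E≢0 = ℕ.m*n≢0 q (t ℕ.* J)
        b^V≢0 : NonZero (b ℕ.^ V)
        b^V≢0 = ℕ.m^n≢0 b V
      split : ∀ x y z → (x ℕ.* (y ℕ.* z)) ℕ.^ E ≡ x ℕ.^ E ℕ.* (y ℕ.^ E ℕ.* z ℕ.^ E)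
      split x y z = trans (^-distribʳ-* x (y ℕ.* z) E) (cong (x ℕ.^ E ℕ.*_) (^-distribʳ-* y z E))
      V-split : b ℕ.^ V ≡ b ℕ.^ (s⁺ ℕ.* (q ℕ.* J)) ℕ.* b ℕ.^ (q ℕ.* t) ℕ.* b ℕ.^ (r⁻ ℕ.* (t ℕ.* J))
      V-split = trans (ℕ.^-distribˡ-+-* b (s⁺ ℕ.* (q ℕ.* J) ℕ.+ q ℕ.* t) (r⁻ ℕ.* (t ℕ.* J)))
        (cong (ℕ._* b ℕ.^ (r⁻ ℕ.* (t ℕ.* J))) (ℕ.^-distribˡ-+-* b (s⁺ ℕ.* (q ℕ.* J)) (q ℕ.* t)))
      shuffle₁ : ∀ a c d e f g → a ℕ.* (c ℕ.* d) ℕ.* (e ℕ.* f ℕ.* g) ≡ (a ℕ.* g) ℕ.* ((e ℕ.* c) ℕ.* (f ℕ.* d))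
      shuffle₁ = solve-∀
      shuffle₂ : ∀ a c d e f → (a ℕ.* c) ℕ.* ((d ℕ.* e) ℕ.* f) ≡ d ℕ.* (c ℕ.* f) ℕ.* (a ℕ.* e)
      shuffle₂ = solve-∀
      raise : ∀ x y n e → (x ℕ.^ n ℕ.* y) ℕ.^ e ≡ x ℕ.^ (n ℕ.* e) ℕ.* y ℕ.^ e
      raise x y n e = trans (^-distribʳ-* (x ℕ.^ n) y e) (cong (ℕ._* y ℕ.^ e) (ℕ.^-*-assoc x n e))
      low : m ℕ.^ E ℕ.* b ℕ.^ (r⁻ ℕ.* (t ℕ.* J)) ℕ.≤ b ℕ.^ (r⁺ ℕ.* (t ℕ.* J)) ℕ.* k ℕ.^ E
      low = subst₂ ℕ._≤_
        (trans (raise m (b ℕ.^ r⁻) q (t ℕ.* J)) (cong (m ℕ.^ E ℕ.*_) (ℕ.^-*-assoc b r⁻ (t ℕ.* J))))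
        (trans (raise b (k ℕ.^ q) r⁺ (t ℕ.* J)) (cong (b ℕ.^ (r⁺ ℕ.* (t ℕ.* J)) ℕ.*_) (ℕ.^-*-assoc k q (t ℕ.* J))))
        (ℕ.^-monoˡ-≤ (t ℕ.* J) (floor-lower r k))
      E≡ : t ℕ.* (q ℕ.* J) ≡ E
      E≡ = (λ (t q J : ℕ) → eq t q J) t q J
        where
        eq : ∀ t q J → t ℕ.* (q ℕ.* J) ≡ q ℕ.* (t ℕ.* J)
        eq = solve-∀
      up : b ℕ.^ (s⁺ ℕ.* (q ℕ.* J)) ℕ.* l ℕ.^ E ℕ.≤ m′ ℕ.^ E ℕ.* b ℕ.^ (s⁻ ℕ.* (q ℕ.* J))
      up = subst₂ ℕ._≤_
        (trans (raise b (l ℕ.^ t) s⁺ (q ℕ.* J)) (cong (b ℕ.^ (s⁺ ℕ.* (q ℕ.* J)) ℕ.*_)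
          (trans (ℕ.^-*-assoc l t (q ℕ.* J)) (cong (l ℕ.^_) E≡))))
        (trans (raise m′ (b ℕ.^ s⁻) t (q ℕ.* J)) (cong₂ ℕ._*_ (cong (m′ ℕ.^_) E≡) (ℕ.^-*-assoc b s⁻ (q ℕ.* J))))
        (ℕ.^-monoˡ-≤ (q ℕ.* J) (ℕ.<⇒≤ (floor-upper s l)))
      E≡′ : J ℕ.* (q ℕ.* t) ≡ E
      E≡′ = eq t q J
        where
        eq : ∀ t q J → J ℕ.* (q ℕ.* t) ≡ q ℕ.* (t ℕ.* J)
        eq = solve-∀
      bern : b ℕ.^ (q ℕ.* t) ℕ.* J ℕ.^ E ℕ.≤ (J ℕ.+ b) ℕ.^ E
      bern = subst₂ ℕ._≤_
        (trans (^-distribʳ-* b (J ℕ.^ J) (q ℕ.* t)) (cong (b ℕ.^ (q ℕ.* t) ℕ.*_)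
          (trans (ℕ.^-*-assoc J J (q ℕ.* t)) (cong (J ℕ.^_) E≡′))))
        (trans (ℕ.^-*-assoc (J ℕ.+ b) J (q ℕ.* t)) (cong ((J ℕ.+ b) ℕ.^_) E≡′))
        (ℕ.^-monoˡ-≤ (q ℕ.* t) (b*J^J≤[J+b]^J J b))

    floor-bound : ∀ r k M .{{_ : NonZero k}} → posPart (↥ r) ℕ.≤ M ℕ.* ↧ₙ r →
      powFloor b r k ℕ.≤ b ℕ.^ M ℕ.* k
    floor-bound r@record{} k M h = ^-cancelˡ-≤ q (begin
      m ℕ.^ q                              ≤⟨ ℕ.m≤m*n (m ℕ.^ q) (b ℕ.^ negPart (↥ r)) {{ℕ.m^n≢0 b (negPart (↥ r))}} ⟩
      m ℕ.^ q ℕ.* b ℕ.^ negPart (↥ r)      ≤⟨ floor-lower r k ⟩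
      b ℕ.^ posPart (↥ r) ℕ.* k ℕ.^ q      ≤⟨ ℕ.*-monoˡ-≤ (k ℕ.^ q) (ℕ.^-monoʳ-≤ b h) ⟩
      b ℕ.^ (M ℕ.* q) ℕ.* k ℕ.^ q          ≡⟨ cong (ℕ._* k ℕ.^ q) (sym (ℕ.^-*-assoc b M q)) ⟩
      (b ℕ.^ M) ℕ.^ q ℕ.* k ℕ.^ q          ≡⟨ sym (^-distribʳ-* (b ℕ.^ M) k q) ⟩
      (b ℕ.^ M ℕ.* k) ℕ.^ q                ∎)
      where
      open ℕ.≤-Reasoning
      q = ↧ₙ r
      m = powFloor b r k

    combine : ∀ m m′ k l E B .{{_ : NonZero k}} →
      let J = suc (E ℕ.* B ℕ.* b) in
      m ℕ.* (l ℕ.* J) ℕ.≤ suc m′ ℕ.* (k ℕ.* (J ℕ.+ b)) → m′ ℕ.≤ B ℕ.* l →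
      E ℕ.* (J ℕ.+ b) ℕ.< l →
      m ℕ.* l ℕ.* E ℕ.< m′ ℕ.* k ℕ.* E ℕ.+ k ℕ.* l
    combine m m′ k l E B h bd large = ℕ.*-cancelʳ-< J _ _ (begin-strict
      m ℕ.* l ℕ.* E ℕ.* J                             ≡⟨ e₁ m l E J ⟩
      E ℕ.* (m ℕ.* (l ℕ.* J))                         ≤⟨ ℕ.*-monoʳ-≤ E h ⟩
      E ℕ.* (suc m′ ℕ.* (k ℕ.* (J ℕ.+ b)))            ≡⟨ e₂ E m′ k J b ⟩
      m′ ℕ.* k ℕ.* E ℕ.* J ℕ.+ (E ℕ.* (J ℕ.+ b) ℕ.* k ℕ.+ m′ ℕ.* (k ℕ.* E ℕ.* b))
        <⟨ ℕ.+-monoʳ-< (m′ ℕ.* k ℕ.* E ℕ.* J) (ℕ.+-mono-<-≤ (ℕ.*-monoˡ-< k large) (ℕ.*-monoˡ-≤ (k ℕ.* E ℕ.* b) bd)) ⟩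
      m′ ℕ.* k ℕ.* E ℕ.* J ℕ.+ (l ℕ.* k ℕ.+ B ℕ.* l ℕ.* (k ℕ.* E ℕ.* b))
        ≡⟨ e₃ (m′ ℕ.* k ℕ.* E) l k B E b ⟩
      (m′ ℕ.* k ℕ.* E ℕ.+ k ℕ.* l) ℕ.* J ∎)
      where
      open ℕ.≤-Reasoning
      J = suc (E ℕ.* B ℕ.* b)
      e₁ : ∀ m l E J → m ℕ.* l ℕ.* E ℕ.* J ≡ E ℕ.* (m ℕ.* (l ℕ.* J))
      e₁ = solve-∀
      e₂ : ∀ E m k J b → E ℕ.* ((1 ℕ.+ m) ℕ.* (k ℕ.* (J ℕ.+ b)))
         ≡ m ℕ.* k ℕ.* E ℕ.* J ℕ.+ (E ℕ.* (J ℕ.+ b) ℕ.* k ℕ.+ m ℕ.* (k ℕ.* E ℕ.* b))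
      e₂ = solve-∀
      e₃ : ∀ x l k B E b → x ℕ.* (1 ℕ.+ E ℕ.* B ℕ.* b) ℕ.+ (l ℕ.* k ℕ.+ B ℕ.* l ℕ.* (k ℕ.* E ℕ.* b))
         ≡ (x ℕ.+ k ℕ.* l) ℕ.* (1 ℕ.+ E ℕ.* B ℕ.* b)
      e₃ = solve-∀

  posPart-negPart : ∀ i → i ℤ.+ + negPart i ≡ + posPart i
  posPart-negPart (+ zero)  = refl
  posPart-negPart (+ suc n) = ℤ.+-identityʳ (+ suc n)
  posPart-negPart -[1+ n ]  = ℤ.+-inverseˡ (+ suc n)

  posPart≢0⇒negPart≡0 : ∀ i → posPart i ≡ 0 ⊎ negPart i ≡ 0
  posPart≢0⇒negPart≡0 (+ zero)  = inj₁ refl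
  posPart≢0⇒negPart≡0 (+ suc n) = inj₂ refl
  posPart≢0⇒negPart≡0 -[1+ n ]  = inj₁ refl

  toℚᵘ-/ : ∀ i n .{{_ : NonZero n}} → ℚ.toℚᵘ (i ℚ./ n) ℚᵘ.≃ (i ℚᵘ./ n)
  toℚᵘ-/ i (suc n) = ℚ.toℚᵘ-fromℚᵘ (ℚᵘ.mkℚᵘ i n)

  near : ∀ r s j → r ℚ.< s ℚ.+ + 1 ℚ./ suc j → Near r s (suc j)
  near r@record{} s@record{} j r< = ℤ.drop‿+≤+ (subst₂ ℤ._≤_ left right
    (ℤ.+-monoˡ-≤ (R⁻ ℤ.* (U ℤ.* J) ℤ.+ S⁻ ℤ.* (Q ℤ.* J)) (ℤ.<⇒≤ cross)))
    where
    Q = ↧ r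
    U = ↧ s
    J = + suc j
    R⁻ = + negPart (↥ r)
    S⁻ = + negPart (↥ s)
    R⁺ = + posPart (↥ r)
    S⁺ = + posPart (↥ s)
    cross : ↥ r ℤ.* (U ℤ.* J) ℤ.< (↥ s ℤ.* J ℤ.+ + 1 ℤ.* U) ℤ.* Q
    cross = ℚᵘ.drop-*<* (ℚᵘ.<-respʳ-≃
      (ℚᵘ.≃-trans (ℚ.toℚᵘ-homo-+ s (+ 1 ℚ./ suc j)) (ℚᵘ.+-congʳ (ℚ.toℚᵘ s) (toℚᵘ-/ (+ 1) (suc j))))
      (ℚ.toℚᵘ-mono-< r<))
    cast : ∀ a b c → + (a ℕ.* (b ℕ.* c)) ≡ + a ℤ.* (+ b ℤ.* + c)
    cast a b c = trans (ℤ.pos-* a (b ℕ.* c)) (cong (+ a ℤ.*_) (ℤ.pos-* b c))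
    open ℤSolver.+-*-Solver
    left : ↥ r ℤ.* (U ℤ.* J) ℤ.+ (R⁻ ℤ.* (U ℤ.* J) ℤ.+ S⁻ ℤ.* (Q ℤ.* J))
         ≡ + (posPart (↥ r) ℕ.* (↧ₙ s ℕ.* suc j) ℕ.+ negPart (↥ s) ℕ.* (↧ₙ r ℕ.* suc j))
    left = trans (trans
      (solve 6 (λ r R S U Q J → r :* (U :* J) :+ (R :* (U :* J) :+ S :* (Q :* J))
                             := (r :+ R) :* (U :* J) :+ S :* (Q :* J)) refl (↥ r) R⁻ S⁻ U Q J)
      (cong (λ z → z ℤ.* (U ℤ.* J) ℤ.+ S⁻ ℤ.* (Q ℤ.* J)) (posPart-negPart (↥ r))))
      (sym (cong₂ ℤ._+_ (cast (posPart (↥ r)) (↧ₙ s) (suc j)) (cast (negPart (↥ s)) (↧ₙ r) (suc j))))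
    right : (↥ s ℤ.* J ℤ.+ + 1 ℤ.* U) ℤ.* Q ℤ.+ (R⁻ ℤ.* (U ℤ.* J) ℤ.+ S⁻ ℤ.* (Q ℤ.* J))
          ≡ + (posPart (↥ s) ℕ.* (↧ₙ r ℕ.* suc j) ℕ.+ ↧ₙ r ℕ.* ↧ₙ s ℕ.+ negPart (↥ r) ℕ.* (↧ₙ s ℕ.* suc j))
    right = trans (trans
      (solve 6 (λ s R S U Q J → (s :* J :+ con (+ 1) :* U) :* Q :+ (R :* (U :* J) :+ S :* (Q :* J))
                             := (s :+ S) :* (Q :* J) :+ Q :* U :+ R :* (U :* J)) refl (↥ s) R⁻ S⁻ U Q J)
      (cong (λ z → z ℤ.* (Q ℤ.* J) ℤ.+ Q ℤ.* U ℤ.+ R⁻ ℤ.* (U ℤ.* J)) (posPart-negPart (↥ s))))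
      (sym (cong₂ ℤ._+_ (cong₂ ℤ._+_ (cast (posPart (↥ s)) (↧ₙ r) (suc j)) (ℤ.pos-* (↧ₙ r) (↧ₙ s)))
        (cast (negPart (↥ r)) (↧ₙ s) (suc j))))

  near⇒bounded : ∀ r s → Near r s 1 → posPart (↥ r) ℕ.≤ suc (posPart (↥ s)) ℕ.* ↧ₙ r
  near⇒bounded r@record{} s@record{} h with posPart≢0⇒negPart≡0 (↥ r)
  ... | inj₁ e = subst (ℕ._≤ suc (posPart (↥ s)) ℕ.* ↧ₙ r) (sym e) ℕ.z≤n
  ... | inj₂ e = ℕ.*-cancelʳ-≤ _ _ t (begin
    posPart (↥ r) ℕ.* t
      ≡⟨ cong (posPart (↥ r) ℕ.*_) (sym (ℕ.*-identityʳ t)) ⟩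
    posPart (↥ r) ℕ.* (t ℕ.* 1)
      ≤⟨ ℕ.m≤m+n (posPart (↥ r) ℕ.* (t ℕ.* 1)) (negPart (↥ s) ℕ.* (q ℕ.* 1)) ⟩
    posPart (↥ r) ℕ.* (t ℕ.* 1) ℕ.+ negPart (↥ s) ℕ.* (q ℕ.* 1)
      ≤⟨ h ⟩
    s⁺ ℕ.* (q ℕ.* 1) ℕ.+ q ℕ.* t ℕ.+ negPart (↥ r) ℕ.* (t ℕ.* 1)
      ≡⟨ cong (λ z → s⁺ ℕ.* (q ℕ.* 1) ℕ.+ q ℕ.* t ℕ.+ z ℕ.* (t ℕ.* 1)) e ⟩
    s⁺ ℕ.* (q ℕ.* 1) ℕ.+ q ℕ.* t ℕ.+ 0
      ≡⟨ ℕ.+-identityʳ _ ⟩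
    s⁺ ℕ.* (q ℕ.* 1) ℕ.+ q ℕ.* t
      ≤⟨ ℕ.+-monoˡ-≤ (q ℕ.* t) (ℕ.*-monoʳ-≤ s⁺ (ℕ.*-monoʳ-≤ q (ℕ.s≤s ℕ.z≤n))) ⟩
    s⁺ ℕ.* (q ℕ.* t) ℕ.+ q ℕ.* t
      ≡⟨ eq s⁺ q t ⟩
    suc s⁺ ℕ.* q ℕ.* t ∎)
    where
    open ℕ.≤-Reasoning
    q = ↧ₙ r
    t = ↧ₙ s
    s⁺ = posPart (↥ s)
    eq : ∀ s q t → s ℕ.* (q ℕ.* t) ℕ.+ q ℕ.* t ≡ (1 ℕ.+ s) ℕ.* q ℕ.* t
    eq = solve-∀

  /-< : ∀ m k m′ l ε → 0ℚ ℚ.< ε → let E = ↧ₙ ε in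
    m ℕ.* suc l ℕ.* E ℕ.< m′ ℕ.* suc k ℕ.* E ℕ.+ suc k ℕ.* suc l →
    + m ℚ./ suc k ℚ.< + m′ ℚ./ suc l ℚ.+ ε
  /-< m k m′ l ε@(ℚ.mkℚ (+ zero) _ _) 0<ε _ = ⊥-elim (ℤ.<-irrefl refl (ℚ.drop-*<* 0<ε))
  /-< m k m′ l ε@(ℚ.mkℚ -[1+ _ ] _ _) 0<ε _ with ℚ.drop-*<* 0<ε
  ... | ()
  /-< m k m′ l ε@(ℚ.mkℚ (+ suc n) e _) 0<ε h = ℚ.toℚᵘ-cancel-<
    (ℚᵘ.<-respˡ-≃ (ℚᵘ.≃-sym (toℚᵘ-/ (+ m) (suc k)))
    (ℚᵘ.<-respʳ-≃ (ℚᵘ.≃-sym (ℚᵘ.≃-trans (ℚ.toℚᵘ-homo-+ (+ m′ ℚ./ suc l) ε)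
                                        (ℚᵘ.+-congˡ (ℚ.toℚᵘ ε) (toℚᵘ-/ (+ m′) (suc l)))))
    (ℚᵘ.*<* (subst₂ ℤ._<_ left right (ℤ.+<+ nat)))))
    where
    E = suc e
    K = suc k
    L = suc l
    eq₁ : ∀ m L E → m ℕ.* (L ℕ.* E) ≡ m ℕ.* L ℕ.* E
    eq₁ = solve-∀
    eq₂ : ∀ m K E L n → m ℕ.* K ℕ.* E ℕ.+ K ℕ.* L ℕ.+ K ℕ.* L ℕ.* n ≡ (m ℕ.* E ℕ.+ (1 ℕ.+ n) ℕ.* L) ℕ.* K
    eq₂ = solve-∀
    nat : m ℕ.* (L ℕ.* E) ℕ.< (m′ ℕ.* E ℕ.+ suc n ℕ.* L) ℕ.* K
    nat = begin-strict
      m ℕ.* (L ℕ.* E)                                  ≡⟨ eq₁ m L E ⟩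
      m ℕ.* L ℕ.* E                                    <⟨ h ⟩
      m′ ℕ.* K ℕ.* E ℕ.+ K ℕ.* L                       ≤⟨ ℕ.m≤m+n _ (K ℕ.* L ℕ.* n) ⟩
      m′ ℕ.* K ℕ.* E ℕ.+ K ℕ.* L ℕ.+ K ℕ.* L ℕ.* n     ≡⟨ eq₂ m′ K E L n ⟩
      (m′ ℕ.* E ℕ.+ suc n ℕ.* L) ℕ.* K ∎
      where open ℕ.≤-Reasoning
    left : + (m ℕ.* (L ℕ.* E)) ≡ + m ℤ.* + (L ℕ.* E)
    left = ℤ.pos-* m (L ℕ.* E)
    right : + ((m′ ℕ.* E ℕ.+ suc n ℕ.* L) ℕ.* K) ≡ (+ m′ ℤ.* + E ℤ.+ + suc n ℤ.* + L) ℤ.* + K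
    right = trans (ℤ.pos-* (m′ ℕ.* E ℕ.+ suc n ℕ.* L) K) (cong (ℤ._* + K)
      (cong₂ ℤ._+_ (ℤ.pos-* m′ E) (ℤ.pos-* (suc n) L)))

  0<1/ : ∀ j → 0ℚ ℚ.< + 1 ℚ./ suc j
  0<1/ j = ℚ.positive⁻¹ (+ 1 ℚ./ suc j) {{ℚ.normalize-pos 1 (suc j)}}

  abstract
    powFloor-cauchy : ∀ b .{{_ : NonZero b}} (x : ℝ) →
      IsCauchy (λ k → + powFloor b (seq x k) (suc k) ℚ./ suc k)
    powFloor-cauchy b x = isCauchy _ λ ε 0<ε →
      let N₁ , f₁ = cauchy x (+ 1 ℚ./ 1) (0<1/ 0)
          M  = suc (posPart (↥ (seq x N₁)))
          B  = b ℕ.^ M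
          E  = ↧ₙ ε
          j  = E ℕ.* B ℕ.* b
          N₂ , f₂ = cauchy x (+ 1 ℚ./ suc j) (0<1/ j)
          N₃ = E ℕ.* (suc j ℕ.+ b)
      in (N₁ ℕ.⊔ N₂) ℕ.⊔ N₃ , λ m n N≤m N≤n →
         let N₁₂≤m = ℕ.m⊔n≤o⇒m≤o (N₁ ℕ.⊔ N₂) N₃ N≤m
             N₁₂≤n = ℕ.m⊔n≤o⇒m≤o (N₁ ℕ.⊔ N₂) N₃ N≤n
             r = seq x m
             s = seq x n
         in /-< (powFloor b r (suc m)) m (powFloor b s (suc n)) n ε 0<ε
              (combine b (powFloor b r (suc m)) (powFloor b s (suc n)) (suc m) (suc n) E B
                (step b r s (suc m) (suc n) (suc j)
                  (near r s j (close⇒< (f₂ m n (ℕ.m⊔n≤o⇒n≤o N₁ N₂ N₁₂≤m) (ℕ.m⊔n≤o⇒n≤o N₁ N₂ N₁₂≤n)))))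
                (floor-bound b s (suc n) M
                  (near⇒bounded s (seq x N₁) (near s (seq x N₁) 0
                    (close⇒< (f₁ n N₁ (ℕ.m⊔n≤o⇒m≤o N₁ N₂ N₁₂≤n) ℕ.≤-refl)))))
                (ℕ.s≤s (ℕ.m⊔n≤o⇒n≤o (N₁ ℕ.⊔ N₂) N₃ N≤n)))

infixr 8 _^ʳ_

_^ʳ_ : (b : ℕ) .{{_ : NonZero b}} → ℝ → ℝ
b ^ʳ x = mkℝ (λ k → + powFloor b (seq x k) (suc k) ℚ./ suc k) (PowFloor.powFloor-cauchy b x)

‖_‖∞ : ∀ {d} → Vector ℝ d → ℝ
‖ v ‖∞ = foldr (λ x r → ∣ x ∣ʳ ⊔ʳ r) 0ʳ v

dist∞ : ∀ {d} → Vector ℝ d → Vector ℝ d → ℝ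
dist∞ p q = ‖ zipWith _-ʳ_ p q ‖∞

InUnitCube : ∀ {d} → Vector ℝ d → Set
InUnitCube p = ∀ k → 0ʳ ≤ʳ p k × p k ≤ʳ 1ʳ

record Line (d : ℕ) : Set where
  field
    base      : Vector ℝ d
    direction : Vector ℝ d
    nonzero   : ∃[ k ] (direction k <ʳ 0ʳ ⊎ 0ʳ <ʳ direction k)

open Line public

infix 4 _∈ˡ_

_∈ˡ_ : ∀ {d} → Vector ℝ d → Line d → Set
q ∈ˡ ℓ = ∃[ t ] (∀ k → q k ≈ʳ base ℓ k +ʳ t *ʳ direction ℓ k)

-- δ is the minimum of dist∞ p q over the points q of ℓ.
IsDistance∞ : ∀ {d} → Vector ℝ d → Line d → ℝ → Set
IsDistance∞ p ℓ δ =
  (∃[ q ] (q ∈ˡ ℓ × δ ≈ʳ dist∞ p q)) × (∀ q → q ∈ˡ ℓ → δ ≤ʳ dist∞ p q)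

-- The proposition is meant for d ≥ 2 and 0 ≤ γ < d; only γ < d is needed for
-- the exponent to make sense.  The quantifiers over ε and n₀ spell
-- out the o(1), uniformly over configurations.
PL : (d : ℕ) (γ : ℝ) → γ <ʳ fromℕ d → Set
PL d γ γ<d =
  ∀ ε → 0ʳ <ʳ ε →
  ∃[ n₀ ] (∀ n .{{_ : NonZero n}} → n₀ ℕ.≤ n →
    (p : Fin n → Vector ℝ d) (ℓ : Fin n → Line d) →
    (∀ i → InUnitCube (p i)) → (∀ i → p i ∈ˡ ℓ i) →
    ∃[ i ] ∃[ j ] (i ≢ j ×
      ∃[ δ ] (IsDistance∞ (p i) (ℓ j) δ ×
        δ ≤ʳ n ^ʳ (-ʳ recip (fromℕ d -ʳ γ) (x<y⇒0<y-x {γ} {fromℕ d} γ<d) +ʳ ε))))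

IsPerfectSquare : ℤ → Set
IsPerfectSquare z = ∃[ k ] z ≡ k ℤ.* k

SquareDifferenceFree : Pred ℤ 0ℓ → Set
SquareDifferenceFree A = ∀ a a′ → A a → A a′ → a ≢ a′ → ¬ IsPerfectSquare (a ℤ.- a′)

-- A subset of [N] = {1, …, N}, seen inside ℤ; index i stands for i + 1.
⟦_⟧ : ∀ {N} → Subset N → Pred ℤ 0ℓ
⟦ A ⟧ z = ∃[ i ] (i ∈ A × z ≡ + suc (toℕ i))

0·5ʳ 0·7666ʳ : ℝ
0·5ʳ    = fromℚ ½
0·7666ʳ = fromℚ (+ 7666 ℚ./ 10000)

0·7666<2 : 0·7666ʳ <ʳ fromℕ 2
0·7666<2 = fromℚ-mono-< (from-yes ((+ 7666 ℚ./ 10000) ℚ.<? (+ 2 ℚ./ 1)))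

{-# OPTIONS --safe #-}

-- If a₁, …, aₛ ≤ N have no two distinct terms differing by a square, and K = ⌊√N⌋, take the points
-- (k / K , (aᵢ + k²) / 2N) with lines of slope kK / N.  The vertical distance from one point to
-- the line of another is |aᵢ - aⱼ + (k - l)²| / 2N, a nonzero multiple of 1 / 2N, so these sK
-- point-line pairs are 1 / 4N separated.  Hence PL₂(γ) forces s ≤ N ^ (3/2 - γ + o(1)), which is
-- the second claim.  Ruzsa's construction in base 205 gives s = N ^ ((1 + log 12 / log 205) / 2),
-- and this exponent exceeds 0.7334 = 3/2 - 0.7666, whence the first claim.

module Submission where

open import Defs
open import Data.Bool.Base using (true; false)
open import Data.Empty using (⊥-elim)
open import Data.Fin.Base using (Fin; zero; suc; toℕ; fromℕ<; remQuot; combine)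
import Data.Fin.Properties as Fin
open import Data.Fin.Subset using (Subset; ∣_∣; _∈_)
open import Data.Integer.Base as ℤ using (+_)
import Data.Integer.Properties as ℤ
import Data.Integer.Solver as ℤSolver
open import Data.Nat.Base as ℕ using (ℕ; NonZero; _≤_; _<_; zero; suc; _+_; _*_; _^_; z≤n; s≤s)
open import Data.Nat.DivMod
  using (_/_; _%_; m≡m%n+[m/n]*n; m%n<n; [m+kn]%n≡m%n; m<n⇒m%n≡m; m*n%n≡0)
import Data.Nat.Properties as ℕ
open import Data.Nat.Tactic.RingSolver using (solve-∀)
open import Data.Product.Base using (∃-syntax; _×_; _,_; proj₁; proj₂)
open import Data.Rational.Base as ℚ using (ℚ; 0ℚ; 1ℚ; ½; ↥_; ↧ₙ_)
import Data.Rational.Properties as ℚ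
import Data.Rational.Solver as ℚSolver
import Data.Rational.Unnormalised.Base as ℚᵘ
import Data.Rational.Unnormalised.Properties as ℚᵘ
open import Data.Sum.Base using (_⊎_; inj₁; inj₂)
import Data.Vec.Base as Vec
open import Data.Vec.Base using (here; there)
open import Data.Vec.Functional using (Vector; []; _∷_)
open import Function.Base using (it)
open import Relation.Binary.Definitions using (tri<; tri≈; tri>)
open import Relation.Binary.PropositionalEquality
  using (_≡_; _≢_; refl; sym; trans; cong; cong₂; subst; subst₂; module ≡-Reasoning)
open import Relation.Nullary using (¬_; yes; no)
open import Relation.Nullary.Decidable using (from-yes; _→-dec_)
open import Algebra.Properties.CommutativeSemigroup ℕ.*-commutativeSemigroup using (xy∙z≈xz∙y)

open PowFloor using (floor-lower; floor-upper; ^-distribʳ-*; ^-cancelˡ-≤)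

-- Naturals as rationals

-- The tangents are chosen because a parabola lies above its tangent by exactly a square: for a
-- fixed term `a` the points lie on y = (a + K² x²) / 2N, so a point of one parabola can meet a
-- tangent of another only if two terms differ by a square.
--
-- Real exponents enter only through rational bounds. Both claims pass through one integer
-- inequality, N^(2p+1) ≤ s^(2q) N^q, that is, s ≥ N^(p/q - 1/2 + 1/2q). It is refuted under `PL` as
-- soon as p/q ≥ 2 - γ + 1/2q. The extra factor N on its left pays for every constant: the rounding
-- of √N, the factor lost to slopes, and the strictness of the final comparison.
--
-- The constant 0.7666 dictates the base. Ruzsa's own base 65 with 7 residues gives the exponent (1
-- + log 7 / log 65) / 2 = 0.73308, short of 0.7334, while base 205 with 12 residues gives 0.73341.

abstract
  -- Opaque, so that `ι n` stays an atom for `rewrite` and the ring solver instead of unfolding to a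
  -- normalised fraction; `ι≡` recovers the value.
  ι : ℕ → ℚ
  ι n = + n ℚ./ 1

  ι≡ : ∀ n → ι n ≡ + n ℚ./ 1
  ι≡ n = refl

toℚᵘ-ι : ∀ n → ℚ.toℚᵘ (ι n) ℚᵘ.≃ ℚᵘ.mkℚᵘ (+ n) 0
toℚᵘ-ι n = subst (λ z → ℚ.toℚᵘ z ℚᵘ.≃ ℚᵘ.mkℚᵘ (+ n) 0) (sym (ι≡ n)) (PowFloor.toℚᵘ-/ (+ n) 1)

ι-+ : ∀ m n → ι (m + n) ≡ ι m ℚ.+ ι n
ι-+ m n = ℚ.toℚᵘ-injective (ℚᵘ.≃-trans (toℚᵘ-ι (m + n)) (ℚᵘ.≃-trans
  (ℚᵘ.*≡* (cong (ℤ._* + 1) (cong₂ ℤ._+_ (sym (ℤ.*-identityʳ (+ m))) (sym (ℤ.*-identityʳ (+ n))))))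
  (ℚᵘ.≃-sym (ℚᵘ.≃-trans (ℚ.toℚᵘ-homo-+ (ι m) (ι n)) (ℚᵘ.+-cong (toℚᵘ-ι m) (toℚᵘ-ι n))))))

ι-* : ∀ m n → ι (m * n) ≡ ι m ℚ.* ι n
ι-* m n = ℚ.toℚᵘ-injective (ℚᵘ.≃-trans (toℚᵘ-ι (m * n)) (ℚᵘ.≃-trans
  (ℚᵘ.*≡* (cong (ℤ._* + 1) (ℤ.pos-* m n)))
  (ℚᵘ.≃-sym (ℚᵘ.≃-trans (ℚ.toℚᵘ-homo-* (ι m) (ι n)) (ℚᵘ.*-cong (toℚᵘ-ι m) (toℚᵘ-ι n))))))

ι-suc : ∀ n → ι (suc n) ≡ 1ℚ ℚ.+ ι n
ι-suc n = trans (ι-+ 1 n) (cong (ℚ._+ ι n) (ι≡ 1))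

ι-mono-≤ : ∀ {m n} → m ≤ n → ι m ℚ.≤ ι n
ι-mono-≤ {m} {n} h = ℚ.toℚᵘ-cancel-≤
  (ℚᵘ.≤-respˡ-≃ (ℚᵘ.≃-sym (toℚᵘ-ι m)) (ℚᵘ.≤-respʳ-≃ (ℚᵘ.≃-sym (toℚᵘ-ι n))
    (ℚᵘ.*≤* (ℤ.*-monoʳ-≤-nonNeg (+ 1) (ℤ.+≤+ h)))))

ι-cancel-≤ : ∀ {m n} → ι m ℚ.≤ ι n → m ≤ n
ι-cancel-≤ {m} {n} h = ℤ.drop‿+≤+ (subst₂ ℤ._≤_ (ℤ.*-identityʳ (+ m)) (ℤ.*-identityʳ (+ n))
  (ℚᵘ.drop-*≤* (ℚᵘ.≤-respˡ-≃ (toℚᵘ-ι m) (ℚᵘ.≤-respʳ-≃ (toℚᵘ-ι n) (ℚ.toℚᵘ-mono-≤ h)))))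

0≤ι : ∀ n → 0ℚ ℚ.≤ ι n
0≤ι n = subst (ℚ._≤ ι n) (ι≡ 0) (ι-mono-≤ z≤n)

0<ι : ∀ n .{{_ : NonZero n}} → 0ℚ ℚ.< ι n
0<ι (suc n) = ℚ.<-≤-trans (subst (0ℚ ℚ.<_) (sym (ι≡ 1)) (ℚ.positive⁻¹ 1ℚ)) (ι-mono-≤ (s≤s z≤n))

/-*-ι : ∀ m k .{{_ : NonZero k}} → (+ m ℚ./ k) ℚ.* ι k ≡ ι m
/-*-ι m k@(suc k-1) = ℚ.toℚᵘ-injective (ℚᵘ.≃-trans (ℚ.toℚᵘ-homo-* (+ m ℚ./ k) (ι k))
  (ℚᵘ.≃-trans (ℚᵘ.*-cong (PowFloor.toℚᵘ-/ (+ m) k) (toℚᵘ-ι k))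
  (ℚᵘ.≃-trans (ℚᵘ.*≡* {ℚᵘ.mkℚᵘ (+ m) k-1 ℚᵘ.* ℚᵘ.mkℚᵘ (+ k) 0} {ℚᵘ.mkℚᵘ (+ m) 0}
    (trans (ℤ.*-identityʳ (+ m ℤ.* + k)) (cong (λ z → + m ℤ.* + z) (sym (ℕ.*-identityʳ k)))))
  (ℚᵘ.≃-sym (toℚᵘ-ι m)))))

numerator-parts : ∀ r → r ℚ.* ι (↧ₙ r) ℚ.+ ι (negPart (↥ r)) ≡ ι (posPart (↥ r))
numerator-parts r@record{} = ℚ.toℚᵘ-injective (ℚᵘ.≃-trans
  (ℚ.toℚᵘ-homo-+ (r ℚ.* ι (↧ₙ r)) (ι (negPart (↥ r))))
  (ℚᵘ.≃-trans (ℚᵘ.+-cong (ℚᵘ.≃-trans (ℚ.toℚᵘ-homo-* r (ι (↧ₙ r))) (ℚᵘ.*-congˡ {ℚ.toℚᵘ r} (toℚᵘ-ι (↧ₙ r)))) (toℚᵘ-ι (negPart (↥ r))))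
  (ℚᵘ.≃-trans (ℚᵘ.*≡* {ℚ.toℚᵘ r ℚᵘ.* ℚᵘ.mkℚᵘ (+ ↧ₙ r) 0 ℚᵘ.+ ℚᵘ.mkℚᵘ (+ negPart (↥ r)) 0}
      {ℚᵘ.mkℚᵘ (+ posPart (↥ r)) 0} eq)
    (ℚᵘ.≃-sym (toℚᵘ-ι (posPart (↥ r)))))))
  where
  open ℤSolver.+-*-Solver
  eq : (↥ r ℤ.* + ↧ₙ r ℤ.* + 1 ℤ.+ + negPart (↥ r) ℤ.* + (↧ₙ r * 1)) ℤ.* + 1 ≡ + posPart (↥ r) ℤ.* + (↧ₙ r * 1 * 1)
  eq = trans (cong (λ z → (↥ r ℤ.* + ↧ₙ r ℤ.* + 1 ℤ.+ + negPart (↥ r) ℤ.* + z) ℤ.* + 1) (ℕ.*-identityʳ (↧ₙ r)))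
    (trans (solve 3 (λ a b c → (a :* b :* con (+ 1) :+ c :* b) :* con (+ 1) := (a :+ c) :* b) refl (↥ r) (+ ↧ₙ r) (+ negPart (↥ r)))
    (cong₂ ℤ._*_ (PowFloor.posPart-negPart (↥ r)) (cong +_ (trans (sym (ℕ.*-identityʳ (↧ₙ r))) (sym (ℕ.*-identityʳ (↧ₙ r * 1)))))))

-- The device for linear arithmetic: known inequalities are added up to `a ≤ b`, and the ring solver
-- checks y - x = b - a.
shift-≤ : ∀ {a b x y} → a ℚ.≤ b → y ℚ.+ a ≡ x ℚ.+ b → x ℚ.≤ y
shift-≤ {a} {b} {x} {y} a≤b e = begin
  x                    ≡⟨ solve 2 (λ x b → x := x :+ b :- b) refl x b ⟩
  x ℚ.+ b ℚ.- b        ≡⟨ cong (ℚ._- b) (sym e) ⟩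
  y ℚ.+ a ℚ.- b        ≤⟨ ℚ.+-monoˡ-≤ (ℚ.- b) (ℚ.+-monoʳ-≤ y a≤b) ⟩
  y ℚ.+ b ℚ.- b        ≡⟨ solve 2 (λ y b → y :+ b :- b := y) refl y b ⟩
  y                    ∎
  where open ℚ.≤-Reasoning
        open ℚSolver.+-*-Solver

shift-< : ∀ {a b x y} → a ℚ.< b → y ℚ.+ a ≡ x ℚ.+ b → x ℚ.< y
shift-< {a} {b} {x} {y} a<b e = begin-strict
  x                    ≡⟨ solve 2 (λ x b → x := x :+ b :- b) refl x b ⟩
  x ℚ.+ b ℚ.- b        ≡⟨ cong (ℚ._- b) (sym e) ⟩
  y ℚ.+ a ℚ.- b        <⟨ ℚ.+-monoˡ-< (ℚ.- b) (ℚ.+-monoʳ-< y a<b) ⟩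
  y ℚ.+ b ℚ.- b        ≡⟨ solve 2 (λ y b → y :+ b :- b := y) refl y b ⟩
  y                    ∎
  where open ℚ.≤-Reasoning
        open ℚSolver.+-*-Solver

*-monoˡ-≤ : ∀ {a b} c → 0ℚ ℚ.≤ c → a ℚ.≤ b → c ℚ.* a ℚ.≤ c ℚ.* b
*-monoˡ-≤ c 0≤c = ℚ.*-monoˡ-≤-nonNeg c {{ℚ.nonNegative 0≤c}}

*-monoʳ-≤ : ∀ {a b} c → 0ℚ ℚ.≤ c → a ℚ.≤ b → a ℚ.* c ℚ.≤ b ℚ.* c
*-monoʳ-≤ c 0≤c = ℚ.*-monoʳ-≤-nonNeg c {{ℚ.nonNegative 0≤c}}

-- In exponent comparisons (u - w) / v stands for an arbitrary rational, with naturals u, v, w.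
exponent-≤ : ∀ r u w v → r ℚ.* ι v ℚ.+ ι w ℚ.≤ ι u →
  posPart (↥ r) * v + w * ↧ₙ r ≤ u * ↧ₙ r + negPart (↥ r) * v
exponent-≤ r u w v h = ι-cancel-≤ (shift-≤ (*-monoʳ-≤ (ι (↧ₙ r)) (0≤ι (↧ₙ r)) h) eq)
  where
  open ℚSolver.+-*-Solver
  d = ↧ₙ r
  n⁺ = posPart (↥ r)
  n⁻ = negPart (↥ r)
  eq : ι (u * d + n⁻ * v) ℚ.+ (r ℚ.* ι v ℚ.+ ι w) ℚ.* ι d ≡ ι (n⁺ * v + w * d) ℚ.+ ι u ℚ.* ι d
  eq rewrite ι-+ (u * d) (n⁻ * v) | ι-+ (n⁺ * v) (w * d) | ι-* u d | ι-* n⁻ v | ι-* n⁺ v | ι-* w d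
           | sym (numerator-parts r) =
    solve 6 (λ r u v w d n → u :* d :+ n :* v :+ (r :* v :+ w) :* d
                           := (r :* d :+ n) :* v :+ w :* d :+ u :* d) refl r (ι u) (ι v) (ι w) (ι d) (ι n⁻)

exponent-≥ : ∀ r u w v → ι u ℚ.≤ r ℚ.* ι v ℚ.+ ι w →
  u * ↧ₙ r + negPart (↥ r) * v ≤ posPart (↥ r) * v + w * ↧ₙ r
exponent-≥ r u w v h = ι-cancel-≤ (shift-≤ (*-monoʳ-≤ (ι (↧ₙ r)) (0≤ι (↧ₙ r)) h) eq)
  where
  open ℚSolver.+-*-Solver
  d = ↧ₙ r
  n⁺ = posPart (↥ r)
  n⁻ = negPart (↥ r)
  eq : ι (n⁺ * v + w * d) ℚ.+ ι u ℚ.* ι d ≡ ι (u * d + n⁻ * v) ℚ.+ (r ℚ.* ι v ℚ.+ ι w) ℚ.* ι d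
  eq rewrite ι-+ (u * d) (n⁻ * v) | ι-+ (n⁺ * v) (w * d) | ι-* u d | ι-* n⁻ v | ι-* n⁺ v | ι-* w d
           | sym (numerator-parts r) =
    solve 6 (λ r u v w d n → (r :* d :+ n) :* v :+ w :* d :+ u :* d
       := u :* d :+ n :* v :+ (r :* v :+ w) :* d) refl r (ι u) (ι v) (ι w) (ι d) (ι n⁻)

-- Bounds on `powFloor` by integer powers

[a^b*c]^d : ∀ a b c d → (a ^ b * c) ^ d ≡ a ^ (b * d) * c ^ d
[a^b*c]^d a b c d = trans (^-distribʳ-* (a ^ b) c d) (cong (_* c ^ d) (ℕ.^-*-assoc a b d))

[a^b*c^d]^e : ∀ a b c d e → (a ^ b * c ^ d) ^ e ≡ a ^ (b * e) * c ^ (d * e)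
[a^b*c^d]^e a b c d e = trans ([a^b*c]^d a b (c ^ d) e) (cong (a ^ (b * e) *_) (ℕ.^-*-assoc c d e))

-- Raising to the power `d` and multiplying by `b ^ (n⁻ * v)` clears the denominator and the
-- negative part of `r`. What remains is the `v`-th power of `floor-lower`, with the exponents of
-- `b` compared by `exponent-≤`.
powFloor-≤ : ∀ b r k u w v .{{_ : NonZero b}} .{{_ : NonZero k}} → r ℚ.* ι v ℚ.+ ι w ℚ.≤ ι u →
  powFloor b r k ^ v * b ^ w ≤ b ^ u * k ^ v
powFloor-≤ b r@record{} k u w v h = ^-cancelˡ-≤ d (ℕ.*-cancelʳ-≤ _ _ (b ^ (n⁻ * v)) {{ℕ.m^n≢0 b (n⁻ * v)}} (begin
  (m ^ v * b ^ w) ^ d * b ^ (n⁻ * v)            ≡⟨ cong (_* b ^ (n⁻ * v)) ([a^b*c^d]^e m v b w d) ⟩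
  m ^ (v * d) * b ^ (w * d) * b ^ (n⁻ * v)      ≡⟨ xy∙z≈xz∙y (m ^ (v * d)) (b ^ (w * d)) (b ^ (n⁻ * v)) ⟩
  m ^ (v * d) * b ^ (n⁻ * v) * b ^ (w * d)      ≡⟨ cong (λ z → m ^ z * b ^ (n⁻ * v) * b ^ (w * d)) (ℕ.*-comm v d) ⟩
  m ^ (d * v) * b ^ (n⁻ * v) * b ^ (w * d)      ≡⟨ cong (_* b ^ (w * d)) (sym ([a^b*c^d]^e m d b n⁻ v)) ⟩
  (m ^ d * b ^ n⁻) ^ v * b ^ (w * d)            ≤⟨ ℕ.*-monoˡ-≤ (b ^ (w * d)) (ℕ.^-monoˡ-≤ v (floor-lower b r k)) ⟩
  (b ^ n⁺ * k ^ d) ^ v * b ^ (w * d)            ≡⟨ cong (_* b ^ (w * d)) ([a^b*c^d]^e b n⁺ k d v) ⟩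
  b ^ (n⁺ * v) * k ^ (d * v) * b ^ (w * d)      ≡⟨ xy∙z≈xz∙y (b ^ (n⁺ * v)) (k ^ (d * v)) (b ^ (w * d)) ⟩
  b ^ (n⁺ * v) * b ^ (w * d) * k ^ (d * v)      ≡⟨ cong (_* k ^ (d * v)) (sym (ℕ.^-distribˡ-+-* b (n⁺ * v) (w * d))) ⟩
  b ^ (n⁺ * v + w * d) * k ^ (d * v)            ≤⟨ ℕ.*-monoˡ-≤ (k ^ (d * v)) (ℕ.^-monoʳ-≤ b (exponent-≤ r u w v h)) ⟩
  b ^ (u * d + n⁻ * v) * k ^ (d * v)            ≡⟨ cong₂ _*_ (ℕ.^-distribˡ-+-* b (u * d) (n⁻ * v)) (cong (k ^_) (ℕ.*-comm d v)) ⟩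
  b ^ (u * d) * b ^ (n⁻ * v) * k ^ (v * d)      ≡⟨ xy∙z≈xz∙y (b ^ (u * d)) (b ^ (n⁻ * v)) (k ^ (v * d)) ⟩
  b ^ (u * d) * k ^ (v * d) * b ^ (n⁻ * v)      ≡⟨ cong (_* b ^ (n⁻ * v)) (sym ([a^b*c^d]^e b u k v d)) ⟩
  (b ^ u * k ^ v) ^ d * b ^ (n⁻ * v)            ∎))
  where
  open ℕ.≤-Reasoning
  d = ↧ₙ r
  n⁺ = posPart (↥ r)
  n⁻ = negPart (↥ r)
  m = powFloor b r k

-- The mirror image, from `floor-upper`; the floor bounds k b^r from above only after adding one,
-- hence `suc`.
powFloor-≥ : ∀ b r k u w v .{{_ : NonZero b}} .{{_ : NonZero k}} → ι u ℚ.≤ r ℚ.* ι v ℚ.+ ι w →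
  b ^ u * k ^ v ≤ suc (powFloor b r k) ^ v * b ^ w
powFloor-≥ b r@record{} k u w v h = ^-cancelˡ-≤ d (ℕ.*-cancelʳ-≤ _ _ (b ^ (n⁻ * v)) {{ℕ.m^n≢0 b (n⁻ * v)}} (begin
  (b ^ u * k ^ v) ^ d * b ^ (n⁻ * v)            ≡⟨ cong (_* b ^ (n⁻ * v)) ([a^b*c^d]^e b u k v d) ⟩
  b ^ (u * d) * k ^ (v * d) * b ^ (n⁻ * v)      ≡⟨ xy∙z≈xz∙y (b ^ (u * d)) (k ^ (v * d)) (b ^ (n⁻ * v)) ⟩
  b ^ (u * d) * b ^ (n⁻ * v) * k ^ (v * d)      ≡⟨ cong₂ _*_ (sym (ℕ.^-distribˡ-+-* b (u * d) (n⁻ * v))) (cong (k ^_) (ℕ.*-comm v d)) ⟩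
  b ^ (u * d + n⁻ * v) * k ^ (d * v)            ≤⟨ ℕ.*-monoˡ-≤ (k ^ (d * v)) (ℕ.^-monoʳ-≤ b (exponent-≥ r u w v h)) ⟩
  b ^ (n⁺ * v + w * d) * k ^ (d * v)            ≡⟨ cong (_* k ^ (d * v)) (ℕ.^-distribˡ-+-* b (n⁺ * v) (w * d)) ⟩
  b ^ (n⁺ * v) * b ^ (w * d) * k ^ (d * v)      ≡⟨ xy∙z≈xz∙y (b ^ (n⁺ * v)) (b ^ (w * d)) (k ^ (d * v)) ⟩
  b ^ (n⁺ * v) * k ^ (d * v) * b ^ (w * d)      ≡⟨ cong (_* b ^ (w * d)) (sym ([a^b*c^d]^e b n⁺ k d v)) ⟩
  (b ^ n⁺ * k ^ d) ^ v * b ^ (w * d)            ≤⟨ ℕ.*-monoˡ-≤ (b ^ (w * d)) (ℕ.^-monoˡ-≤ v (ℕ.<⇒≤ (floor-upper b r k))) ⟩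
  (m ^ d * b ^ n⁻) ^ v * b ^ (w * d)            ≡⟨ cong (_* b ^ (w * d)) ([a^b*c^d]^e m d b n⁻ v) ⟩
  m ^ (d * v) * b ^ (n⁻ * v) * b ^ (w * d)      ≡⟨ cong (λ z → m ^ z * b ^ (n⁻ * v) * b ^ (w * d)) (ℕ.*-comm d v) ⟩
  m ^ (v * d) * b ^ (n⁻ * v) * b ^ (w * d)      ≡⟨ xy∙z≈xz∙y (m ^ (v * d)) (b ^ (n⁻ * v)) (b ^ (w * d)) ⟩
  m ^ (v * d) * b ^ (w * d) * b ^ (n⁻ * v)      ≡⟨ cong (_* b ^ (n⁻ * v)) (sym ([a^b*c^d]^e m v b w d)) ⟩
  (m ^ v * b ^ w) ^ d * b ^ (n⁻ * v)            ∎))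
  where
  open ℕ.≤-Reasoning
  d = ↧ₙ r
  n⁺ = posPart (↥ r)
  n⁻ = negPart (↥ r)
  m = suc (powFloor b r k)

-- Points and lines with rational coefficients

fromℚ-mono-≤ : ∀ {p q} → p ℚ.≤ q → fromℚ p ≤ʳ fromℚ q
fromℚ-mono-≤ {p} {q} p≤q (ε , 0<ε , N , f) = ℚ.<-irrefl refl (begin-strict
  p             ≤⟨ p≤q ⟩
  q             ≡⟨ sym (ℚ.+-identityʳ q) ⟩
  q ℚ.+ 0ℚ      <⟨ ℚ.+-monoʳ-< q 0<ε ⟩
  q ℚ.+ ε       <⟨ f N ℕ.≤-refl ⟩
  p             ∎)
  where open ℚ.≤-Reasoning

point : ℚ → ℚ → Vector ℝ 2
point x y = fromℚ x ∷ fromℚ y ∷ []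

lineThrough : ℚ → ℚ → ℚ → Line 2
lineThrough x y m = record
  { base = point x y ; direction = point 1ℚ m ; nonzero = zero , inj₂ (fromℚ-mono-< (ℚ.positive⁻¹ 1ℚ)) }

point∈lineThrough : ∀ x y m → point x y ∈ˡ lineThrough x y m
point∈lineThrough x y m = 0ʳ , λ k ε 0<ε → 0 , λ n _ → subst (ℚ._< ε) (sym (on-line k n)) 0<ε
  where
  open ℚSolver.+-*-Solver
  vanishes : ∀ a b → ℚ.∣ a ℚ.- (a ℚ.+ 0ℚ ℚ.* b) ∣ ≡ 0ℚ
  vanishes a b = cong ℚ.∣_∣ (solve 2 (λ a b → a :- (a :+ con 0ℚ :* b) := con 0ℚ) refl a b)
  on-line : ∀ k n → ℚ.∣ seq (point x y k) n ℚ.- (seq (point x y k) n ℚ.+ 0ℚ ℚ.* seq (point 1ℚ m k) n) ∣ ≡ 0ℚ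
  on-line zero       n = vanishes x 1ℚ
  on-line (suc zero) n = vanishes y m

-- The maximum is what `∣_∣ʳ` unfolds to at one index. Membership in a line holds only up to `_≈ʳ_`,
-- so at that index the coordinate `q` may miss its parametrised value `a` by η.
near-via : ∀ p q a {D η} → ℚ.∣ q ℚ.- a ∣ ℚ.< η → (p ℚ.- q) ℚ.⊔ (ℚ.- (p ℚ.- q)) ℚ.≤ D →
  p ℚ.- a ℚ.≤ D ℚ.+ η × a ℚ.- p ℚ.≤ D ℚ.+ η
near-via p q a {D} {η} q≈a h = (begin
  p ℚ.- a                     ≡⟨ solve 3 (λ p q a → p :- a := (p :- q) :+ (q :- a)) refl p q a ⟩
  (p ℚ.- q) ℚ.+ (q ℚ.- a)     ≤⟨ ℚ.+-mono-≤ (ℚ.≤-trans (ℚ.p≤p⊔q (p ℚ.- q) (ℚ.- (p ℚ.- q))) h) (∣∣<⇒≤ q≈a) ⟩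
  D ℚ.+ η                     ∎) , (begin
  a ℚ.- p                     ≡⟨ solve 3 (λ p q a → a :- p := :- (p :- q) :+ (a :- q)) refl p q a ⟩
  ℚ.- (p ℚ.- q) ℚ.+ (a ℚ.- q) ≤⟨ ℚ.+-mono-≤ (ℚ.≤-trans (ℚ.p≤q⊔p (p ℚ.- q) (ℚ.- (p ℚ.- q))) h)
                                   (∣∣<⇒≤ (subst (ℚ._< η) (∣a-b∣-sym q a) q≈a)) ⟩
  D ℚ.+ η                     ∎)
  where
  open ℚ.≤-Reasoning
  open ℚSolver.+-*-Solver
  ∣∣<⇒≤ : ∀ {x} → ℚ.∣ x ∣ ℚ.< η → x ℚ.≤ η
  ∣∣<⇒≤ {x} h = ℚ.≤-trans (p≤∣p∣ x) (ℚ.<⇒≤ h)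

+slope*≤ : ∀ {m u v E} → 0ℚ ℚ.≤ m → m ℚ.≤ 1ℚ → 0ℚ ℚ.≤ E → u ℚ.≤ E → v ℚ.≤ E → v ℚ.+ m ℚ.* u ℚ.≤ E ℚ.+ E
+slope*≤ {m} {u} {v} {E} 0≤m m≤1 0≤E u≤E v≤E = ℚ.+-mono-≤ v≤E (begin
  m ℚ.* u     ≤⟨ *-monoˡ-≤ m 0≤m u≤E ⟩
  m ℚ.* E     ≤⟨ *-monoʳ-≤ E 0≤E m≤1 ⟩
  1ℚ ℚ.* E    ≡⟨ ℚ.*-identityˡ E ⟩
  E           ∎)
  where open ℚ.≤-Reasoning

height : (p₀ p₁ b₀ b₁ m : ℚ) → ℚ
height p₀ p₁ b₀ b₁ m = (p₁ ℚ.- b₁) ℚ.- m ℚ.* (p₀ ℚ.- b₀)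

-- Up to the approximation error 2η this says h / 2 ≤ δ; slopes up to 1 cost the factor 2.
distance-≥ : ∀ p₀ p₁ b₀ b₁ m h δ → 0ℚ ℚ.≤ m → m ℚ.≤ 1ℚ →
  h ℚ.≤ height p₀ p₁ b₀ b₁ m ⊎ h ℚ.≤ ℚ.- height p₀ p₁ b₀ b₁ m →
  IsDistance∞ (point p₀ p₁) (lineThrough b₀ b₁ m) δ →
  ∀ η → 0ℚ ℚ.< η →
  ∃[ M ] (∀ k → M ≤ k → h ℚ.≤ (seq δ k ℚ.+ (η ℚ.+ η)) ℚ.+ (seq δ k ℚ.+ (η ℚ.+ η)))
distance-≥ p₀ p₁ b₀ b₁ m h δ 0≤m m≤1 far ((q , (t , q≈) , δ≈) , _) η 0<η
  with δ≈ η 0<η | q≈ zero η 0<η | q≈ (suc zero) η 0<η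
... | M , f | M₀ , f₀ | M₁ , f₁ = M ℕ.⊔ (M₀ ℕ.⊔ M₁) , λ k M≤k →
  bound (seq δ k) (seq (q zero) k) (seq (q (suc zero)) k) (seq t k)
    (f k (ℕ.m⊔n≤o⇒m≤o M _ M≤k))
    (f₀ k (ℕ.m⊔n≤o⇒m≤o M₀ M₁ (ℕ.m⊔n≤o⇒n≤o M _ M≤k)))
    (f₁ k (ℕ.m⊔n≤o⇒n≤o M₀ M₁ (ℕ.m⊔n≤o⇒n≤o M _ M≤k)))
  where
  bound : ∀ d q₀ q₁ t → let D₁ = ((p₁ ℚ.- q₁) ℚ.⊔ (ℚ.- (p₁ ℚ.- q₁))) ℚ.⊔ 0ℚ
                            D = ((p₀ ℚ.- q₀) ℚ.⊔ (ℚ.- (p₀ ℚ.- q₀))) ℚ.⊔ D₁ in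
    ℚ.∣ d ℚ.- D ∣ ℚ.< η → ℚ.∣ q₀ ℚ.- (b₀ ℚ.+ t ℚ.* 1ℚ) ∣ ℚ.< η → ℚ.∣ q₁ ℚ.- (b₁ ℚ.+ t ℚ.* m) ∣ ℚ.< η →
    h ℚ.≤ (d ℚ.+ (η ℚ.+ η)) ℚ.+ (d ℚ.+ (η ℚ.+ η))
  bound d q₀ q₁ t d≈D q₀≈ q₁≈ = ℚ.≤-trans (h≤2E far) (ℚ.+-mono-≤ E≤ E≤)
    where
    open ℚ.≤-Reasoning
    open ℚSolver.+-*-Solver
    ∣u∣ = (p₀ ℚ.- q₀) ℚ.⊔ (ℚ.- (p₀ ℚ.- q₀))
    ∣v∣ = (p₁ ℚ.- q₁) ℚ.⊔ (ℚ.- (p₁ ℚ.- q₁))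
    D = ∣u∣ ℚ.⊔ (∣v∣ ℚ.⊔ 0ℚ)
    E = D ℚ.+ η
    a₀ = b₀ ℚ.+ t ℚ.* 1ℚ
    a₁ = b₁ ℚ.+ t ℚ.* m
    ∣u∣≤D = ℚ.p≤p⊔q ∣u∣ (∣v∣ ℚ.⊔ 0ℚ)
    ∣v∣≤D = ℚ.≤-trans (ℚ.p≤p⊔q ∣v∣ 0ℚ) (ℚ.p≤q⊔p ∣u∣ (∣v∣ ℚ.⊔ 0ℚ))
    0≤D = ℚ.≤-trans (ℚ.p≤q⊔p ∣v∣ 0ℚ) (ℚ.p≤q⊔p ∣u∣ (∣v∣ ℚ.⊔ 0ℚ))
    0≤E : 0ℚ ℚ.≤ E
    0≤E = ℚ.+-mono-≤ 0≤D (ℚ.<⇒≤ 0<η)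
    u± = near-via p₀ q₀ a₀ q₀≈ ∣u∣≤D
    v± = near-via p₁ q₁ a₁ q₁≈ ∣v∣≤D
    E≤ : E ℚ.≤ d ℚ.+ (η ℚ.+ η)
    E≤ = ℚ.≤-trans (ℚ.+-monoˡ-≤ η (ℚ.<⇒≤ (close⇒< {D} {d} (subst (ℚ._< η) (∣a-b∣-sym d D) d≈D))))
      (ℚ.≤-reflexive (ℚ.+-assoc d η η))
    -- Moving the base along the line to (a₀, a₁) leaves the height unchanged, as `t` cancels. What
    -- is left are coordinate differences bounded by `E`.
    h≤2E : h ℚ.≤ height p₀ p₁ b₀ b₁ m ⊎ h ℚ.≤ ℚ.- height p₀ p₁ b₀ b₁ m → h ℚ.≤ E ℚ.+ E
    h≤2E (inj₁ h≤) = begin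
      h                                        ≤⟨ h≤ ⟩
      height p₀ p₁ b₀ b₁ m                     ≡⟨ solve 6 (λ p₀ p₁ b₀ b₁ m t → (p₁ :- b₁) :- m :* (p₀ :- b₀)
                                                     := (p₁ :- (b₁ :+ t :* m)) :+ m :* ((b₀ :+ t :* con 1ℚ) :- p₀))
                                                    refl p₀ p₁ b₀ b₁ m t ⟩
      (p₁ ℚ.- a₁) ℚ.+ m ℚ.* (a₀ ℚ.- p₀)        ≤⟨ +slope*≤ 0≤m m≤1 0≤E (proj₂ u±) (proj₁ v±) ⟩
      E ℚ.+ E                                  ∎
    h≤2E (inj₂ h≤) = begin
      h                                        ≤⟨ h≤ ⟩
      ℚ.- height p₀ p₁ b₀ b₁ m                 ≡⟨ solve 6 (λ p₀ p₁ b₀ b₁ m t → :- ((p₁ :- b₁) :- m :* (p₀ :- b₀))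
                                                     := ((b₁ :+ t :* m) :- p₁) :+ m :* (p₀ :- (b₀ :+ t :* con 1ℚ)))
                                                    refl p₀ p₁ b₀ b₁ m t ⟩
      (a₁ ℚ.- p₁) ℚ.+ m ℚ.* (p₀ ℚ.- a₀)        ≤⟨ +slope*≤ 0≤m m≤1 0≤E (proj₁ u±) (proj₂ v±) ⟩
      E ℚ.+ E                                  ∎

-- Configurations from square-difference-free sequences

-- The case t = 0 makes the sequence injective, so its length is the size of a set.
SquareDifferenceFreeSeq : ∀ {s} → (Fin s → ℕ) → Set
SquareDifferenceFreeSeq f = ∀ i j t → f i ≡ f j + t * t → i ≡ j

-- Here `d` is |m - n|, and the identity is the expansion of (m - n)² with the subtraction moved
-- across.
square-gap : ∀ m n → ∃[ d ] (m * m + n * n ≡ (m * n + m * n) + d * d × (d ≡ 0 → m ≡ n))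
square-gap m n with ℕ.≤-total m n
... | inj₁ m≤n = n ℕ.∸ m , subst (λ z → m * m + z * z ≡ (m * z + m * z) + (n ℕ.∸ m) * (n ℕ.∸ m)) (ℕ.m+[n∸m]≡n m≤n) (expand m (n ℕ.∸ m)) ,
  λ d≡0 → ℕ.≤-antisym m≤n (ℕ.m∸n≡0⇒m≤n d≡0)
  where
  expand : ∀ m d → m * m + (m + d) * (m + d) ≡ (m * (m + d) + m * (m + d)) + d * d
  expand = solve-∀
... | inj₂ n≤m = m ℕ.∸ n , subst (λ z → z * z + n * n ≡ (z * n + z * n) + (m ℕ.∸ n) * (m ℕ.∸ n)) (ℕ.m+[n∸m]≡n n≤m) (expand n (m ℕ.∸ n)) ,
  λ d≡0 → ℕ.≤-antisym (ℕ.m∸n≡0⇒m≤n d≡0) n≤m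
  where
  expand : ∀ n d → (n + d) * (n + d) + n * n ≡ ((n + d) * n + (n + d) * n) + d * d
  expand = solve-∀

-- Cancelling 2kl leaves f j = f i + (k - l)². Square-difference-freeness gives i = j, and then (k -
-- l)² = 0.
no-coincidence : ∀ {s} {f : Fin s → ℕ} → SquareDifferenceFreeSeq f → ∀ i j k l →
  f i + (k * k + l * l) ≡ f j + (k * l + k * l) → i ≡ j × k ≡ l
no-coincidence {f = f} sdf i j k l e with square-gap k l
... | d , gap , d≡0⇒k≡l = i≡j , d≡0⇒k≡l d≡0
  where
  f+d²≡f : f i + d * d ≡ f j
  f+d²≡f = ℕ.+-cancelʳ-≡ (k * l + k * l) _ _ (trans (shuffle (f i) (d * d) (k * l + k * l)) (trans (cong (λ z → f i + z) (sym gap)) e))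
    where
    shuffle : ∀ a b c → a + b + c ≡ a + (c + b)
    shuffle = solve-∀
  i≡j = sym (sdf j i d (sym f+d²≡f))
  d≡0 : d ≡ 0
  d≡0 with ℕ.m*n≡0⇒m≡0∨n≡0 d (ℕ.+-cancelˡ-≡ (f j) (d * d) 0 (trans (subst (λ z → f z + d * d ≡ f j) i≡j f+d²≡f) (sym (ℕ.+-identityʳ (f j)))))
  ... | inj₁ e = e
  ... | inj₂ e = e

-- The points (k / K , (a + k²) / 2N) for a in the sequence and k < K, each with the tangent
-- to its parabola: one point is (a - a′ + (k - k′)²) / 2N above the line of another.
module Configuration {s} (f : Fin s → ℕ) (sdf : SquareDifferenceFreeSeq f)
  (N K : ℕ) .{{_ : NonZero N}} .{{_ : NonZero K}} (f≤N : ∀ i → f i ≤ N) (K²≤N : K * K ≤ N) where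

  private
    instance
      N+N≢0 : NonZero (N + N)
      N+N≢0 = ℕ.>-nonZero (ℕ.≤-trans (ℕ.>-nonZero⁻¹ N) (ℕ.m≤m+n N N))

  h-inverse = pos-inv (0<ι (N + N))
  κ-inverse = pos-inv (0<ι K)

  -- `h` is 1 / 2N and `κ` is 1 / K; computations use the relations `2N*h≡1` and `K*κ≡1` instead of
  -- fractions.
  h κ : ℚ
  h = proj₁ h-inverse
  κ = proj₁ κ-inverse

  0<h : 0ℚ ℚ.< h
  0<h = proj₁ (proj₂ h-inverse)

  0≤h = ℚ.<⇒≤ 0<h

  2N*h≡1 : ι (N + N) ℚ.* h ≡ 1ℚ
  2N*h≡1 = proj₂ (proj₂ h-inverse)

  0≤κ : 0ℚ ℚ.≤ κ
  0≤κ = ℚ.<⇒≤ (proj₁ (proj₂ κ-inverse))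

  K*κ≡1 : ι K ℚ.* κ ≡ 1ℚ
  K*κ≡1 = proj₂ (proj₂ κ-inverse)

  a c : Fin (s * K) → ℕ
  a i = f (proj₁ (remQuot K i))
  c i = toℕ (proj₂ (remQuot {s} K i))

  x y m : Fin (s * K) → ℚ
  x i = ι (c i) ℚ.* κ
  y i = ι (a i + c i * c i) ℚ.* h
  m i = ι (c i * K + c i * K) ℚ.* h

  p : Fin (s * K) → Vector ℝ 2
  p i = point (x i) (y i)

  ℓ : Fin (s * K) → Line 2
  ℓ i = lineThrough (x i) (y i) (m i)

  c<K : ∀ i → c i < K
  c<K i = Fin.toℕ<n (proj₂ (remQuot {s} K i))

  0≤ι* : ∀ n {r} → 0ℚ ℚ.≤ r → 0ℚ ℚ.≤ ι n ℚ.* r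
  0≤ι* n {r} 0≤r = subst (ℚ._≤ ι n ℚ.* r) (ℚ.*-zeroʳ (ι n)) (*-monoˡ-≤ (ι n) (0≤ι n) 0≤r)

  ι*≤1 : ∀ {n n′ r} → 0ℚ ℚ.≤ r → ι n′ ℚ.* r ≡ 1ℚ → n ≤ n′ → ι n ℚ.* r ℚ.≤ 1ℚ
  ι*≤1 {n} {n′} {r} 0≤r e n≤n′ = ℚ.≤-trans (*-monoʳ-≤ r 0≤r (ι-mono-≤ n≤n′)) (ℚ.≤-reflexive e)

  0≤m : ∀ i → 0ℚ ℚ.≤ m i
  0≤m i = 0≤ι* (c i * K + c i * K) 0≤h

  m≤1 : ∀ i → m i ℚ.≤ 1ℚ
  m≤1 i = ι*≤1 0≤h 2N*h≡1 (ℕ.+-mono-≤ cK≤N cK≤N)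
    where cK≤N = ℕ.≤-trans (ℕ.*-monoˡ-≤ K (ℕ.<⇒≤ (c<K i))) K²≤N

  p-inCube : ∀ i → InUnitCube (p i)
  p-inCube i zero       = fromℚ-mono-≤ (0≤ι* (c i) 0≤κ) , fromℚ-mono-≤ (ι*≤1 0≤κ K*κ≡1 (ℕ.<⇒≤ (c<K i)))
  p-inCube i (suc zero) = fromℚ-mono-≤ (0≤ι* (a i + c i * c i) 0≤h) ,
    fromℚ-mono-≤ (ι*≤1 0≤h 2N*h≡1 (ℕ.+-mono-≤ (f≤N _)
      (ℕ.≤-trans (ℕ.*-mono-≤ (ℕ.<⇒≤ (c<K i)) (ℕ.<⇒≤ (c<K i))) K²≤N)))

  p∈ℓ : ∀ i → p i ∈ˡ ℓ i
  p∈ℓ i = point∈lineThrough (x i) (y i) (m i)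

  -- Once `K * κ` becomes 1, the quadratic part is c_i² - c_j² - 2 c_j (c_i - c_j) = (c_i - c_j)².
  -- It is kept as a difference of two naturals so that trichotomy in ℕ can be applied to them.
  height≡ : ∀ i j → height (x i) (y i) (x j) (y j) (m j) ≡
    (ι (a i + (c i * c i + c j * c j)) ℚ.- ι (a j + (c i * c j + c i * c j))) ℚ.* h
  height≡ i j
    rewrite ι-+ (a i) (c i * c i) | ι-+ (a j) (c j * c j) | ι-+ (c j * K) (c j * K)
          | ι-+ (a i) (c i * c i + c j * c j) | ι-+ (c i * c i) (c j * c j)
          | ι-+ (a j) (c i * c j + c i * c j) | ι-+ (c i * c j) (c i * c j)
          | ι-* (c i) (c i) | ι-* (c j) (c j) | ι-* (c i) (c j) | ι-* (c j) K
    = trans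
      (solve 7 (λ ai aj ci cj K κ h →
          ((ai :+ ci :* ci) :* h :- (aj :+ cj :* cj) :* h) :- (cj :* K :+ cj :* K) :* h :* (ci :* κ :- cj :* κ)
          := (ai :+ ci :* ci :- aj :- cj :* cj) :* h :- (cj :+ cj) :* h :* (ci :- cj) :* (K :* κ))
        refl (ι (a i)) (ι (a j)) (ι (c i)) (ι (c j)) (ι K) κ h)
      (trans (cong (λ z → (ι (a i) ℚ.+ ι (c i) ℚ.* ι (c i) ℚ.- ι (a j) ℚ.- ι (c j) ℚ.* ι (c j)) ℚ.* h
                       ℚ.- (ι (c j) ℚ.+ ι (c j)) ℚ.* h ℚ.* (ι (c i) ℚ.- ι (c j)) ℚ.* z) K*κ≡1)
      (solve 5 (λ ai aj ci cj h →
          (ai :+ ci :* ci :- aj :- cj :* cj) :* h :- (cj :+ cj) :* h :* (ci :- cj) :* con 1ℚ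
          := (ai :+ (ci :* ci :+ cj :* cj) :- (aj :+ (ci :* cj :+ ci :* cj))) :* h)
        refl (ι (a i)) (ι (a j)) (ι (c i)) (ι (c j)) h))
    where open ℚSolver.+-*-Solver

  <⇒gap : ∀ {n n′} → n < n′ → h ℚ.≤ (ι n′ ℚ.- ι n) ℚ.* h
  <⇒gap {n} {n′} n<n′ = shift-≤ (*-monoʳ-≤ h 0≤h (subst (ℚ._≤ ι n′) (ι-suc n) (ι-mono-≤ n<n′)))
    (solve 3 (λ n n′ h → (n′ :- n) :* h :+ (con 1ℚ :+ n) :* h := h :+ n′ :* h) refl (ι n) (ι n′) h)
    where open ℚSolver.+-*-Solver

  -- Distinct naturals differ by at least 1, which the factor `h` turns into a gap of `h`; equality
  -- is excluded by `no-coincidence`.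
  separated : ∀ i j → i ≢ j → h ℚ.≤ height (x i) (y i) (x j) (y j) (m j) ⊎ h ℚ.≤ ℚ.- height (x i) (y i) (x j) (y j) (m j)
  separated i j i≢j with ℕ.<-cmp (a i + (c i * c i + c j * c j)) (a j + (c i * c j + c i * c j))
  ... | tri< A<B _ _ = inj₂ (subst (h ℚ.≤_) (trans flip (cong ℚ.-_ (sym (height≡ i j)))) (<⇒gap A<B))
    where
    A = ι (a i + (c i * c i + c j * c j))
    B = ι (a j + (c i * c j + c i * c j))
    flip : (B ℚ.- A) ℚ.* h ≡ ℚ.- ((A ℚ.- B) ℚ.* h)
    flip = solve 3 (λ A B h → (B :- A) :* h := :- ((A :- B) :* h)) refl A B h
      where open ℚSolver.+-*-Solver
  ... | tri> _ _ B<A = inj₁ (subst (h ℚ.≤_) (sym (height≡ i j)) (<⇒gap B<A))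
  ... | tri≈ _ A≡B _ = ⊥-elim (i≢j (trans (sym (Fin.combine-remQuot {s} K i)) (trans
    (cong₂ combine (proj₁ same) (Fin.toℕ-injective (proj₂ same)))
    (Fin.combine-remQuot {s} K j))))
    where same = no-coincidence sdf (proj₁ (remQuot K i)) (proj₁ (remQuot K j)) (c i) (c j) A≡B

-- From `PL` to a bound on square-difference-free sequences

sqrt-floor : ∀ N → ∃[ K ] (K * K ≤ N × N < suc K * suc K)
sqrt-floor zero    = 0 , z≤n , s≤s z≤n
sqrt-floor (suc N) with sqrt-floor N
... | K , K²≤N , N<K′² with suc K * suc K ℕ.≤? suc N
...   | yes h = suc K , h , ℕ.≤-<-trans N<K′² (ℕ.*-mono-< (ℕ.n<1+n (suc K)) (ℕ.n<1+n (suc K)))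
...   | no ¬h = K , ℕ.m≤n⇒m≤1+n K²≤N , ℕ.≰⇒> ¬h

-- With N ≤ 4K² the hypothesis on `s` gives (sK)^(2q) ≥ N^(2p) · N / 4^q, and the surplus factor N
-- covers both 4^q and 64^p = 8^(2p). Both sides are squared so that √N never appears.
many-points : ∀ p q N K s .{{_ : NonZero q}} → 64 ^ p * 4 ^ q ≤ N → N ≤ 4 * (K * K) →
  N ^ suc (p * 2) ≤ s ^ (q * 2) * N ^ q → (8 * N) ^ p ≤ (s * K) ^ q
many-points p q N K s large N≤4K² h = ^-cancelˡ-≤ 2 (ℕ.*-cancelʳ-≤ _ _ (4 ^ q) {{ℕ.m^n≢0 4 q}} (begin
  ((8 * N) ^ p) ^ 2 * 4 ^ q                    ≡⟨ cong (_* 4 ^ q) (double (8 * N) p) ⟩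
  ((8 * N) ^ 2) ^ p * 4 ^ q                    ≡⟨ cong (λ z → z ^ p * 4 ^ q) (^-distribʳ-* 8 N 2) ⟩
  (64 * N ^ 2) ^ p * 4 ^ q                     ≡⟨ cong (_* 4 ^ q) (^-distribʳ-* 64 (N ^ 2) p) ⟩
  64 ^ p * (N ^ 2) ^ p * 4 ^ q                 ≡⟨ xy∙z≈xz∙y (64 ^ p) ((N ^ 2) ^ p) (4 ^ q) ⟩
  64 ^ p * 4 ^ q * (N ^ 2) ^ p                 ≤⟨ ℕ.*-monoˡ-≤ ((N ^ 2) ^ p) large ⟩
  N * (N ^ 2) ^ p                              ≡⟨ cong (N *_) (trans (sym (double N p)) (ℕ.^-*-assoc N p 2)) ⟩
  N ^ suc (p * 2)                              ≤⟨ h ⟩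
  s ^ (q * 2) * N ^ q                          ≤⟨ ℕ.*-monoʳ-≤ (s ^ (q * 2)) (ℕ.^-monoˡ-≤ q N≤4K²) ⟩
  s ^ (q * 2) * (4 * (K * K)) ^ q              ≡⟨ cong₂ _*_ (trans (sym (ℕ.^-*-assoc s q 2)) (double s q)) (^-distribʳ-* 4 (K * K) q) ⟩
  (s ^ 2) ^ q * (4 ^ q * (K * K) ^ q)          ≡⟨ shuffle₁ ((s ^ 2) ^ q) (4 ^ q) ((K * K) ^ q) ⟩
  (s ^ 2) ^ q * (K * K) ^ q * 4 ^ q            ≡⟨ cong (_* 4 ^ q) (sym (^-distribʳ-* (s ^ 2) (K * K) q)) ⟩
  (s ^ 2 * (K * K)) ^ q * 4 ^ q                ≡⟨ cong (λ z → z ^ q * 4 ^ q) (shuffle₂ s K) ⟩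
  ((s * K) ^ 2) ^ q * 4 ^ q                    ≡⟨ cong (_* 4 ^ q) (sym (double (s * K) q)) ⟩
  ((s * K) ^ q) ^ 2 * 4 ^ q                    ∎))
  where
  open ℕ.≤-Reasoning
  double : ∀ n e → (n ^ e) ^ 2 ≡ (n ^ 2) ^ e
  double n e = trans (ℕ.^-*-assoc n e 2) (trans (cong (n ^_) (ℕ.*-comm e 2)) (sym (ℕ.^-*-assoc n 2 e)))
  shuffle₁ : ∀ a b c → a * (b * c) ≡ a * c * b
  shuffle₁ = solve-∀
  shuffle₂ : ∀ s K → s * (s * 1) * (K * K) ≡ (s * K) * ((s * K) * 1)
  shuffle₂ = solve-∀

-- Since y ≤ -q / p, b^y ≤ b^(-q/p) ≤ 1 / w, which is `h`. The approximant `μ` is rounded down, so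
-- no error term arises.
power-≤ : ∀ b μ y k p q w h → .{{_ : NonZero b}} .{{_ : NonZero p}} →
  μ ≡ + powFloor b y (suc k) ℚ./ suc k → y ℚ.* ι p ℚ.+ ι q ℚ.≤ 0ℚ → w ^ p ≤ b ^ q →
  0ℚ ℚ.≤ h → ι w ℚ.* h ≡ 1ℚ → μ ℚ.≤ h
power-≤ b μ y k p q w h μ≡ y≤ w^p≤b^q 0≤h wh≡1 = begin
  μ                            ≡⟨ sym (ℚ.*-identityʳ μ) ⟩
  μ ℚ.* 1ℚ                     ≡⟨ cong (μ ℚ.*_) (sym wh≡1) ⟩
  μ ℚ.* (ι w ℚ.* h)            ≡⟨ sym (ℚ.*-assoc μ (ι w) h) ⟩
  μ ℚ.* ι w ℚ.* h              ≤⟨ *-monoʳ-≤ h 0≤h μw≤1 ⟩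
  1ℚ ℚ.* h                     ≡⟨ ℚ.*-identityˡ h ⟩
  h                            ∎
  where
  open ℚ.≤-Reasoning
  n = powFloor b y (suc k)
  n*w≤k : n * w ≤ suc k
  n*w≤k = ^-cancelˡ-≤ p (ℕ.≤-trans (ℕ.≤-reflexive (^-distribʳ-* n w p))
    (ℕ.≤-trans (ℕ.*-monoʳ-≤ (n ^ p) w^p≤b^q)
    (ℕ.≤-trans (powFloor-≤ b y (suc k) 0 q p (subst (y ℚ.* ι p ℚ.+ ι q ℚ.≤_) (sym (ι≡ 0)) y≤))
      (ℕ.≤-reflexive (ℕ.+-identityʳ _)))))
  μw≤1 : μ ℚ.* ι w ℚ.≤ 1ℚ
  μw≤1 = ℚ.*-cancelʳ-≤-pos (ι (suc k)) {{ℚ.positive (0<ι (suc k))}} (ℚ.≤-trans (ℚ.≤-reflexive eq)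
    (ℚ.≤-trans (ι-mono-≤ n*w≤k) (ℚ.≤-reflexive (sym (ℚ.*-identityˡ (ι (suc k)))))))
    where
    open ℚSolver.+-*-Solver
    eq : μ ℚ.* ι w ℚ.* ι (suc k) ≡ ι (n * w)
    eq = trans (solve 3 (λ a b c → a :* b :* c := a :* c :* b) refl μ (ι w) (ι (suc k)))
      (trans (cong (λ z → z ℚ.* ι (suc k) ℚ.* ι w) μ≡)
      (trans (cong (ℚ._* ι w) (/-*-ι n (suc k))) (sym (ι-* n w))))

-- Since β ≤ (2p - 1) / 2q, the slack 1 / 2p² is absorbed by 1 / β - q / p.
reciprocal-slack : ∀ β I e p q .{{_ : NonZero q}} → 0ℚ ℚ.≤ β → 0ℚ ℚ.≤ I → 0ℚ ℚ.≤ e → I ℚ.* β ≡ 1ℚ →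
  ι (p * (p + p)) ℚ.* e ≡ 1ℚ →
  β ℚ.* ι (q + q) ℚ.+ 1ℚ ℚ.≤ ι (p + p) → (ℚ.- I ℚ.+ e) ℚ.* ι p ℚ.+ ι q ℚ.≤ 0ℚ
reciprocal-slack β I e p q 0≤β 0≤I 0≤e Iβ≡1 2p²e≡1 β≤ = shift-≤ scaled
  (trans (solve 5 (λ P Q I e β → con 0ℚ :+ I :* ((e :* P :+ Q) :* β) := I :* β :* (e :* P :+ Q)) refl P Q I e β)
  (trans (cong (ℚ._* (e ℚ.* P ℚ.+ Q)) Iβ≡1)
  (solve 4 (λ P Q I e → con 1ℚ :* (e :* P :+ Q) := (:- I :+ e) :* P :+ Q :+ I :* P) refl P Q I e)))
  where
  open ℚSolver.+-*-Solver
  P = ι p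
  Q = ι q
  X : β ℚ.* (Q ℚ.+ Q) ℚ.+ 1ℚ ℚ.≤ P ℚ.+ P
  X = subst₂ ℚ._≤_ (cong (λ z → β ℚ.* z ℚ.+ 1ℚ) (ι-+ q q)) (ι-+ p p) β≤
  2p²e≡1′ : P ℚ.* (P ℚ.+ P) ℚ.* e ≡ 1ℚ
  2p²e≡1′ = trans (cong (ℚ._* e) (sym (trans (ι-* p (p + p)) (cong (P ℚ.*_) (ι-+ p p))))) 2p²e≡1
  half : ∀ {a b} → a ℚ.≤ b → ½ ℚ.* a ℚ.≤ ½ ℚ.* b
  half = *-monoˡ-≤ ½ (ℚ.<⇒≤ (ℚ.positive⁻¹ ½))
  1≤Q : 1ℚ ℚ.≤ Q
  1≤Q = subst (ℚ._≤ Q) (ι≡ 1) (ι-mono-≤ (ℕ.>-nonZero⁻¹ q))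
  β≤P : β ℚ.≤ P
  β≤P = begin
    β                                       ≡⟨ sym (ℚ.*-identityʳ β) ⟩
    β ℚ.* 1ℚ                                ≤⟨ *-monoˡ-≤ β 0≤β 1≤Q ⟩
    β ℚ.* Q                                 ≤⟨ shift-≤ (ℚ.+-mono-≤ (half X) (ℚ.<⇒≤ (ℚ.positive⁻¹ ½))) (solve 3 (λ β Q P →
                                                P :+ (con ½ :* (β :* (Q :+ Q) :+ con 1ℚ) :+ con 0ℚ) := β :* Q :+ (con ½ :* (P :+ P) :+ con ½)) refl β Q P) ⟩
    P                                       ∎
    where open ℚ.≤-Reasoning
  eP≥0 : 0ℚ ℚ.≤ e ℚ.* P
  eP≥0 = subst (ℚ._≤ e ℚ.* P) (ℚ.*-zeroʳ e) (*-monoˡ-≤ e 0≤e (0≤ι p))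
  -- Halving `X` gives βQ + 1/2 ≤ P, while ePβ ≤ eP² = 1/2.
  key : (e ℚ.* P ℚ.+ Q) ℚ.* β ℚ.≤ P
  key = shift-≤ (ℚ.+-mono-≤ (half X) (*-monoˡ-≤ (e ℚ.* P) eP≥0 β≤P))
    (trans (solve 4 (λ P Q e β → P :+ (con ½ :* (β :* (Q :+ Q) :+ con 1ℚ) :+ e :* P :* β)
        := con ½ :* con 1ℚ :+ (P :+ (β :* Q :+ e :* P :* β))) refl P Q e β)
    (trans (cong (λ z → ½ ℚ.* z ℚ.+ (P ℚ.+ (β ℚ.* Q ℚ.+ e ℚ.* P ℚ.* β))) (sym 2p²e≡1′))
    (solve 4 (λ P Q e β → con ½ :* (P :* (P :+ P) :* e) :+ (P :+ (β :* Q :+ e :* P :* β))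
        := (e :* P :+ Q) :* β :+ (con ½ :* (P :+ P) :+ e :* P :* P)) refl P Q e β)))
  scaled : I ℚ.* ((e ℚ.* P ℚ.+ Q) ℚ.* β) ℚ.≤ I ℚ.* P
  scaled = *-monoˡ-≤ I 0≤I key

-- A sequence this long yields n = sK pairs with n ≥ (8N)^(p/q). As q / p lies below 1 / (2 - γ)
-- with room for the slack `e`, `PL` would produce a distance of at most 1 / 8N, half of the true
-- separation 1 / 4N.
PL⇒sparse : (γ : ℝ) (γ<2 : γ <ʳ fromℕ 2) → PL 2 γ γ<2 →
  ∀ p q .{{_ : NonZero p}} .{{_ : NonZero q}} →
  ∃[ M ] (∀ k → M ≤ k → seq (fromℕ 2 -ʳ γ) k ℚ.* ι (q + q) ℚ.+ 1ℚ ℚ.≤ ι (p + p)) →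
  ∃[ N₀ ] (∀ N .{{_ : NonZero N}} → N₀ ≤ N → ∀ s (f : Fin s → ℕ) →
    SquareDifferenceFreeSeq f → (∀ i → f i ≤ N) →
    ¬ N ^ suc (p * 2) ≤ s ^ (q * 2) * N ^ q)
-- N ≥ n₀² forces K ≥ n₀, hence sK ≥ n₀; the other bound is the threshold of `many-points`.
PL⇒sparse γ γ<2@(δ₀ , 0<δ₀ , Mγ , above) pl p q (M₁ , β≤) = n₀ * n₀ ℕ.⊔ 64 ^ p * 4 ^ q , bound
  where
  2p² = p * (p + p)
  instance
    2p²≢0 : NonZero 2p²
    2p²≢0 = ℕ.m*n≢0 p (p + p) {{it}} {{ℕ.>-nonZero (ℕ.≤-trans (ℕ.>-nonZero⁻¹ p) (ℕ.m≤m+n p p))}}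
  slack = pos-inv (0<ι 2p²)
  e = proj₁ slack
  0<e = proj₁ (proj₂ slack)
  2p²*e≡1 = proj₂ (proj₂ slack)
  applied = pl (fromℚ e) (fromℚ-mono-< 0<e)
  n₀ = proj₁ applied
  β = fromℕ 2 -ʳ γ
  0<β = x<y⇒0<y-x {γ} {fromℕ 2} γ<2
  exponent = -ʳ recip β 0<β +ʳ fromℚ e
  open Recip β δ₀ 0<δ₀ using (den; inv; inv-pos; den-nonZero)

  exponent≤ : ∀ k → Mγ ≤ k → M₁ ≤ k → seq exponent k ℚ.* ι p ℚ.+ ι q ℚ.≤ 0ℚ
  exponent≤ k Mγ≤k M₁≤k = reciprocal-slack (seq β k) (inv k) e p q 0≤β (ℚ.<⇒≤ (inv-pos k)) (ℚ.<⇒≤ 0<e)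
    inv*β 2p²*e≡1 (β≤ k M₁≤k)
    where
    δ₀<β : δ₀ ℚ.< seq β k
    δ₀<β = subst (ℚ._< seq β k) (ℚ.+-identityˡ δ₀) (proj₂ (proj₂ (proj₂ 0<β)) k Mγ≤k)
    0≤β : 0ℚ ℚ.≤ seq β k
    0≤β = ℚ.<⇒≤ (ℚ.<-trans 0<δ₀ δ₀<β)
    -- Past `Mγ` the cut-off `δ₀` inside `recip` is inactive, so `inv k` is the true reciprocal.
    den≡β : den k ≡ seq β k
    den≡β = ℚ.p≤q⇒p⊔q≡q (ℚ.<⇒≤ δ₀<β)
    inv*β : inv k ℚ.* seq β k ≡ 1ℚ
    inv*β = trans (cong (inv k ℚ.*_) (sym den≡β)) (ℚ.*-inverseˡ (den k) {{den-nonZero k}})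

  bound : ∀ N .{{_ : NonZero N}} → n₀ * n₀ ℕ.⊔ 64 ^ p * 4 ^ q ≤ N → ∀ s (f : Fin s → ℕ) →
    SquareDifferenceFreeSeq f → (∀ i → f i ≤ N) → ¬ N ^ suc (p * 2) ≤ s ^ (q * 2) * N ^ q
  -- For s = 0 there are no points, whereas `PL` speaks of n ≥ 1; here the right side of `h`
  -- vanishes and the left does not.
  bound N N₀≤N zero f sdf f≤N h = ℕ.<⇒≱ (ℕ.m^n>0 N (suc (p * 2))) (subst (λ z → N ^ suc (p * 2) ≤ z * N ^ q) (0^ (q * 2) {{ℕ.m*n≢0 q 2}}) h)
    where
    0^ : ∀ n .{{_ : NonZero n}} → 0 ^ n ≡ 0
    0^ (suc n) = refl
  bound N N₀≤N s@(suc s-1) f sdf f≤N h = contradiction (proj₂ applied (s * K) n₀≤n C.p C.ℓ C.p-inCube C.p∈ℓ)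
    where
    root = sqrt-floor N
    K = proj₁ root
    K²≤N = proj₁ (proj₂ root)
    N<K′² = proj₂ (proj₂ root)
    1≤K : 1 ≤ K
    1≤K = ℕ.≮⇒≥ λ { (s≤s K≤0) → ℕ.<⇒≱ N<K′² (ℕ.≤-trans (ℕ.*-mono-≤ (s≤s K≤0) (s≤s K≤0)) (ℕ.>-nonZero⁻¹ N)) }
    instance
      K≢0 : NonZero K
      K≢0 = ℕ.>-nonZero 1≤K
      n≢0 : NonZero (s * K)
      n≢0 = ℕ.m*n≢0 s K
    n₀≤K : n₀ ≤ K
    n₀≤K = ℕ.≮⇒≥ λ K<n₀ → ℕ.<⇒≱ N<K′² (ℕ.≤-trans (ℕ.*-mono-≤ K<n₀ K<n₀) (ℕ.m⊔n≤o⇒m≤o (n₀ * n₀) _ N₀≤N))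
    n₀≤n : n₀ ≤ s * K
    n₀≤n = ℕ.≤-trans n₀≤K (ℕ.m≤m+n K (s-1 * K))
    N≤4K² : N ≤ 4 * (K * K)
    N≤4K² = ℕ.≤-trans (ℕ.<⇒≤ N<K′²) (ℕ.≤-trans (ℕ.*-mono-≤ K′≤2K K′≤2K) (ℕ.≤-reflexive (eq K)))
      where
      K′≤2K : suc K ≤ K + K
      K′≤2K = ℕ.+-monoˡ-≤ K 1≤K
      eq : ∀ K → (K + K) * (K + K) ≡ 4 * (K * K)
      eq = solve-∀
    module C = Configuration f sdf N K f≤N K²≤N

    [8N]^p≤n^q : (8 * N) ^ p ≤ (s * K) ^ q
    [8N]^p≤n^q = many-points p q N K s (ℕ.m⊔n≤o⇒n≤o (n₀ * n₀) _ N₀≤N) N≤4K² h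

    -- In units of η = h/16: the power is at most h/4 = 4η and the distance at least h/2 - 2η = 6η,
    -- so a strict gap of η fits between them.
    η = + 1 ℚ./ 16 ℚ.* C.h
    0<η : 0ℚ ℚ.< η
    0<η = pos* (ℚ.positive⁻¹ (+ 1 ℚ./ 16)) C.0<h

    8N*4η≡1 : ι (8 * N) ℚ.* (+ 1 ℚ./ 4 ℚ.* C.h) ≡ 1ℚ
    8N*4η≡1 = trans (cong (ℚ._* (+ 1 ℚ./ 4 ℚ.* C.h)) (trans (cong ι (four N)) (trans (ι-* 4 (N + N)) (cong (ℚ._* ι (N + N)) (ι≡ 4)))))
      (trans (solve 2 (λ n h → con (+ 4 ℚ./ 1) :* n :* (con (+ 1 ℚ./ 4) :* h) := n :* h) refl (ι (N + N)) C.h) C.2N*h≡1)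
      where
      open ℚSolver.+-*-Solver
      four : ∀ N → 8 * N ≡ 4 * (N + N)
      four = solve-∀

    power<δ : ∀ δ μ → μ ℚ.≤ + 1 ℚ./ 4 ℚ.* C.h → C.h ℚ.≤ (δ ℚ.+ (η ℚ.+ η)) ℚ.+ (δ ℚ.+ (η ℚ.+ η)) → μ ℚ.+ η ℚ.< δ
    power<δ δ μ μ≤ h≤ = shift-< (ℚ.+-mono-<-≤ 0<η (ℚ.+-mono-≤ μ≤ (*-monoˡ-≤ ½ (ℚ.<⇒≤ (ℚ.positive⁻¹ ½)) h≤)))
      (solve 3 (λ δ μ h → let η = con (+ 1 ℚ./ 16) :* h in
         δ :+ (con 0ℚ :+ (μ :+ con ½ :* h))
         := μ :+ η :+ (η :+ (con (+ 1 ℚ./ 4) :* h :+ con ½ :* (δ :+ (η :+ η) :+ (δ :+ (η :+ η)))))) refl δ μ C.h)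
      where open ℚSolver.+-*-Solver

    contradiction : ¬ (∃[ i ] ∃[ j ] (i ≢ j × ∃[ δ ] (IsDistance∞ (C.p i) (C.ℓ j) δ × δ ≤ʳ (s * K) ^ʳ exponent)))
    contradiction (i , j , i≢j , δ , dist , δ≤) =
      let M₂ , far = distance-≥ (C.x i) (C.y i) (C.x j) (C.y j) (C.m j) C.h δ (C.0≤m j) (C.m≤1 j) (C.separated i j i≢j) dist η 0<η
      in δ≤ (η , 0<η , M₂ ℕ.⊔ (Mγ ℕ.⊔ M₁) , λ k M≤k → power<δ (seq δ k) _
      (power-≤ (s * K) _ (seq exponent k) k p q (8 * N) _ refl
        (exponent≤ k (ℕ.m⊔n≤o⇒m≤o Mγ M₁ (ℕ.m⊔n≤o⇒n≤o M₂ _ M≤k)) (ℕ.m⊔n≤o⇒n≤o Mγ M₁ (ℕ.m⊔n≤o⇒n≤o M₂ _ M≤k)))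
        [8N]^p≤n^q (ℚ.<⇒≤ (pos* (ℚ.positive⁻¹ (+ 1 ℚ./ 4)) C.0<h)) 8N*4η≡1)
      (far k (ℕ.m⊔n≤o⇒m≤o M₂ _ M≤k)))

-- Subsets of [N]

-- The product is the numerator of ε, a positive integer.
archimedean : ∀ {ε} → 0ℚ ℚ.< ε → 1ℚ ℚ.≤ ε ℚ.* ι (↧ₙ ε)
archimedean {ε} 0<ε with PowFloor.posPart≢0⇒negPart≡0 (↥ ε)
... | inj₁ e = ⊥-elim (ℚ.<-irrefl refl (begin-strict
  0ℚ                                         <⟨ pos* 0<ε (0<ι (↧ₙ ε)) ⟩
  ε ℚ.* ι (↧ₙ ε)                             ≡⟨ sym (ℚ.+-identityʳ _) ⟩
  ε ℚ.* ι (↧ₙ ε) ℚ.+ 0ℚ                      ≤⟨ ℚ.+-monoʳ-≤ (ε ℚ.* ι (↧ₙ ε)) (0≤ι (negPart (↥ ε))) ⟩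
  ε ℚ.* ι (↧ₙ ε) ℚ.+ ι (negPart (↥ ε))       ≡⟨ numerator-parts ε ⟩
  ι (posPart (↥ ε))                          ≡⟨ trans (cong ι e) (ι≡ 0) ⟩
  0ℚ                                         ∎))
  where open ℚ.≤-Reasoning
... | inj₂ e = subst (1ℚ ℚ.≤_) (sym ε*d≡n) (subst (ℚ._≤ ι (posPart (↥ ε))) (ι≡ 1) (ι-mono-≤ (ℕ.n≢0⇒n>0 n≢0)))
  where
  ε*d≡n : ε ℚ.* ι (↧ₙ ε) ≡ ι (posPart (↥ ε))
  ε*d≡n = trans (sym (ℚ.+-identityʳ _)) (trans (cong (ε ℚ.* ι (↧ₙ ε) ℚ.+_) (sym (trans (cong ι e) (ι≡ 0)))) (numerator-parts ε))
  n≢0 : posPart (↥ ε) ≢ 0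
  n≢0 n≡0 = ℚ.<-irrefl (sym (trans ε*d≡n (trans (cong ι n≡0) (ι≡ 0)))) (pos* 0<ε (0<ι (↧ₙ ε)))

ℕ-floor : ∀ r → 0ℚ ℚ.≤ r → ∃[ n ] (ι n ℚ.≤ r × r ℚ.≤ 1ℚ ℚ.+ ι n)
ℕ-floor r 0≤r = descend (posPart (↥ r)) (ℚ.≤-trans r≤r*d (ℚ.≤-trans r*d≤n (ℚ.≤-trans (ι-mono-≤ (ℕ.n≤1+n _)) (ℚ.≤-reflexive (ι-suc _)))))
  where
  open ℚ.≤-Reasoning
  r≤r*d : r ℚ.≤ r ℚ.* ι (↧ₙ r)
  r≤r*d = ℚ.≤-trans (ℚ.≤-reflexive (sym (ℚ.*-identityʳ r)))
    (*-monoˡ-≤ r 0≤r (subst (ℚ._≤ ι (↧ₙ r)) (ι≡ 1) (ι-mono-≤ (ℕ.>-nonZero⁻¹ (↧ₙ r)))))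
  r*d≤n : r ℚ.* ι (↧ₙ r) ℚ.≤ ι (posPart (↥ r))
  r*d≤n = begin
    r ℚ.* ι (↧ₙ r)                             ≡⟨ sym (ℚ.+-identityʳ _) ⟩
    r ℚ.* ι (↧ₙ r) ℚ.+ 0ℚ                      ≤⟨ ℚ.+-monoʳ-≤ (r ℚ.* ι (↧ₙ r)) (0≤ι (negPart (↥ r))) ⟩
    r ℚ.* ι (↧ₙ r) ℚ.+ ι (negPart (↥ r))       ≡⟨ numerator-parts r ⟩
    ι (posPart (↥ r))                          ∎
  descend : ∀ n → r ℚ.≤ 1ℚ ℚ.+ ι n → ∃[ n ] (ι n ℚ.≤ r × r ℚ.≤ 1ℚ ℚ.+ ι n)
  descend zero    r≤ = 0 , subst (ℚ._≤ r) (sym (ι≡ 0)) 0≤r , r≤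
  descend (suc n) r≤ with ℚ.≤-total (ι (suc n)) r
  ... | inj₁ n≤r = suc n , n≤r , r≤
  ... | inj₂ r≤n = descend n (subst (r ℚ.≤_) (ι-suc n) r≤n)

members : ∀ {N} (A : Subset N) → Fin ∣ A ∣ → Fin N
members (true Vec.∷ A)  zero    = zero
members (true Vec.∷ A)  (suc i) = suc (members A i)
members (false Vec.∷ A) i       = suc (members A i)

members-∈ : ∀ {N} (A : Subset N) i → members A i ∈ A
members-∈ (true Vec.∷ A)  zero    = here
members-∈ (true Vec.∷ A)  (suc i) = there (members-∈ A i)
members-∈ (false Vec.∷ A) i       = there (members-∈ A i)

members-injective : ∀ {N} (A : Subset N) i j → members A i ≡ members A j → i ≡ j
members-injective (true Vec.∷ A)  zero    zero    e = refl
members-injective (true Vec.∷ A)  (suc i) (suc j) e = cong suc (members-injective A i j (Fin.suc-injective e))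
members-injective (false Vec.∷ A) i       j       e = members-injective A i j (Fin.suc-injective e)

-- The offset by one between indices and elements cancels in differences. Equal members force equal
-- indices, which settles t = 0.
members-sdf : ∀ {N} (A : Subset N) → SquareDifferenceFree ⟦ A ⟧ → SquareDifferenceFreeSeq (λ i → toℕ (members A i))
members-sdf A sdf i j t e with members A i Fin.≟ members A j
... | yes same = members-injective A i j same
... | no  diff = ⊥-elim (sdf (+ suc (toℕ (members A i))) (+ suc (toℕ (members A j)))
  (members A i , members-∈ A i , refl) (members A j , members-∈ A j , refl)
  (λ eq → diff (Fin.toℕ-injective (ℕ.suc-injective (ℤ.+-injective eq))))
  (+ t , trans (cong (λ z → + suc z ℤ.- + suc (toℕ (members A j))) e) (difference (toℕ (members A j)) t)))
  where
  difference : ∀ b t → + suc (b + t * t) ℤ.- + suc b ≡ + t ℤ.* + t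
  difference b t = trans (cong (ℤ._- + suc b) (trans (ℤ.pos-+ (suc b) (t * t)) (cong (λ z → + suc b ℤ.+ z) (ℤ.pos-* t t))))
    (solve 2 (λ b t → b :+ t :* t :- b := t :* t) refl (+ suc b) (+ t))
    where open ℤSolver.+-*-Solver

-- The gap ε of the strict inequality absorbs the rounding: once K is at least the denominator of ε,
-- εK ≥ 1, so even the floor plus one is at most sK, as `powFloor-≥` requires.
power<⇒≤ : ∀ N (x : ℝ) s u v w .{{_ : NonZero N}} → N ^ʳ x <ʳ fromℕ s →
  ∃[ M ] (∀ k → M ≤ k → ι u ℚ.≤ seq x k ℚ.* ι v ℚ.+ ι w) → N ^ u ≤ s ^ v * N ^ w
power<⇒≤ N x s u v w (ε , 0<ε , M , below) (M′ , u≤) = ℕ.*-cancelʳ-≤ _ _ (K ^ v) {{ℕ.m^n≢0 K v}} (begin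
  N ^ u * K ^ v                     ≤⟨ powFloor-≥ N (seq x k) K u w v (u≤ k M′≤k) ⟩
  suc m ^ v * N ^ w                 ≤⟨ ℕ.*-monoˡ-≤ (N ^ w) (ℕ.^-monoˡ-≤ v m<sK) ⟩
  (s * K) ^ v * N ^ w               ≡⟨ cong (_* N ^ w) (^-distribʳ-* s K v) ⟩
  s ^ v * K ^ v * N ^ w             ≡⟨ xy∙z≈xz∙y (s ^ v) (K ^ v) (N ^ w) ⟩
  s ^ v * N ^ w * K ^ v             ∎)
  where
  open ℕ.≤-Reasoning
  k = M ℕ.⊔ (M′ ℕ.⊔ ↧ₙ ε)
  K = suc k
  m = powFloor N (seq x k) K
  M≤k = ℕ.m≤m⊔n M (M′ ℕ.⊔ ↧ₙ ε)
  M′≤k = ℕ.≤-trans (ℕ.m≤m⊔n M′ (↧ₙ ε)) (ℕ.m≤n⊔m M _)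
  d≤K = ℕ.≤-trans (ℕ.≤-trans (ℕ.m≤n⊔m M′ (↧ₙ ε)) (ℕ.m≤n⊔m M _)) (ℕ.n≤1+n k)
  m<sK : suc m ≤ s * K
  m<sK = ι-cancel-≤ (R.begin
    ι (suc m)                                 R.≡⟨ ι-suc m ⟩
    1ℚ ℚ.+ ι m                                R.≤⟨ ℚ.+-monoˡ-≤ (ι m) (ℚ.≤-trans (archimedean 0<ε) (*-monoˡ-≤ ε (ℚ.<⇒≤ 0<ε) (ι-mono-≤ d≤K))) ⟩
    ε ℚ.* ι K ℚ.+ ι m                         R.≡⟨ cong (ε ℚ.* ι K ℚ.+_) (sym (/-*-ι m K)) ⟩
    ε ℚ.* ι K ℚ.+ μ ℚ.* ι K                   R.≡⟨ solve 3 (λ e m k → e :* k :+ m :* k := (m :+ e) :* k) refl ε μ (ι K) ⟩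
    (μ ℚ.+ ε) ℚ.* ι K                         R.≤⟨ *-monoʳ-≤ (ι K) (0≤ι K) (ℚ.<⇒≤ (below k M≤k)) ⟩
    (+ s ℚ./ 1) ℚ.* ι K                       R.≡⟨ cong (ℚ._* ι K) (sym (ι≡ s)) ⟩
    ι s ℚ.* ι K                               R.≡⟨ sym (ι-* s K) ⟩
    ι (s * K)                                 R.∎)
    where
    module R = ℚ.≤-Reasoning
    open ℚSolver.+-*-Solver
    μ = + m ℚ./ K

-- p / q exceeds 3/2 - c by at least 1 / 2q, and 1 - c + ε exceeds p / q - 1/2 by at least 1 / 2q;
-- this is possible once q ε ≥ 3.
approximate-exponent : (c ε : ℝ) → 0·5ʳ +ʳ c <ʳ fromℕ 2 → 0ʳ <ʳ ε →
  ∃[ p ] ∃[ q ] (NonZero p × NonZero q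
    × (∃[ M ] (∀ k → M ≤ k → seq (fromℕ 2 -ʳ (0·5ʳ +ʳ c)) k ℚ.* ι (q + q) ℚ.+ 1ℚ ℚ.≤ ι (p + p)))
    × (∃[ M ] (∀ k → M ≤ k → ι (suc (p * 2)) ℚ.≤ seq (1ʳ -ʳ c +ʳ ε) k ℚ.* ι (q * 2) ℚ.+ ι q)))
approximate-exponent c ε (δ , 0<δ , M₁ , above) (ε₁ , 0<ε₁ , M₂ , ε>) =
  -- Here n = ⌊qβ⌋ at index `M`. In 2p = 2n + 4, two units round qβ up, one is the required 1, and
  -- one covers the drift of `c`, as 2qν = 1. In `lower`, 2p + 1 = 2n + 5 and one more unit of drift
  -- cost 6, paid by 2qε₁ ≥ 6; hence the 3 in `q`.
  suc (suc n) , q , _ , q≢0 , (M , upper) , (M ℕ.⊔ M₂ , lower)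
  where
  open ℚSolver.+-*-Solver
  q = 3 * ↧ₙ ε₁
  q≢0 : NonZero q
  q≢0 = ℕ.m*n≢0 3 (↧ₙ ε₁)
  2q≢0 : NonZero (q + q)
  2q≢0 = ℕ.>-nonZero (ℕ.≤-trans (ℕ.>-nonZero⁻¹ q {{q≢0}}) (ℕ.m≤m+n q q))
  inverse = pos-inv (0<ι (q + q) {{2q≢0}})
  ν = proj₁ inverse
  0<ν = proj₁ (proj₂ inverse)
  2qν≡1 : (ι q ℚ.+ ι q) ℚ.* ν ≡ 1ℚ
  2qν≡1 = trans (cong (ℚ._* ν) (sym (ι-+ q q))) (proj₂ (proj₂ inverse))
  M₃ = proj₁ (cauchy c ν 0<ν)
  M = M₁ ℕ.⊔ M₃
  c≈ : ∀ m n → M ≤ m → M ≤ n → seq c m ℚ.≤ seq c n ℚ.+ ν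
  c≈ m n M≤m M≤n = ℚ.<⇒≤ (close⇒< {seq c m} {seq c n} (proj₂ (cauchy c ν 0<ν) m n (ℕ.m⊔n≤o⇒n≤o M₁ M₃ M≤m) (ℕ.m⊔n≤o⇒n≤o M₁ M₃ M≤n)))
  Q = ι q
  β : ℕ → ℚ
  β k = + 2 ℚ./ 1 ℚ.- (½ ℚ.+ seq c k)
  0≤β : 0ℚ ℚ.≤ β M
  0≤β = shift-≤ (ℚ.+-mono-≤ (ℚ.<⇒≤ 0<δ) (ℚ.<⇒≤ (above M (ℕ.m≤m⊔n M₁ M₃))))
    (solve 2 (λ c δ → con (+ 2 ℚ./ 1) :- (con ½ :+ c) :+ (con 0ℚ :+ (con ½ :+ c :+ δ)) := con 0ℚ :+ (δ :+ con (+ 2 ℚ./ 1))) refl (seq c M) δ)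
  r = Q ℚ.* β M
  floored = ℕ-floor r (subst (ℚ._≤ r) (ℚ.*-zeroʳ Q) (*-monoˡ-≤ Q (0≤ι q) 0≤β))
  n = proj₁ floored
  n≤r = proj₁ (proj₂ floored)
  r≤1+n = proj₂ (proj₂ floored)

  3≤Qε₁ : + 3 ℚ./ 1 ℚ.≤ Q ℚ.* ε₁
  3≤Qε₁ = ℚ.≤-trans (*-monoˡ-≤ (+ 3 ℚ./ 1) (ℚ.<⇒≤ (ℚ.positive⁻¹ (+ 3 ℚ./ 1))) (archimedean 0<ε₁))
    (ℚ.≤-reflexive (trans (solve 2 (λ e d → con (+ 3 ℚ./ 1) :* (e :* d) := con (+ 3 ℚ./ 1) :* d :* e) refl ε₁ (ι (↧ₙ ε₁)))
      (cong (ℚ._* ε₁) (trans (cong (ℚ._* ι (↧ₙ ε₁)) (sym (ι≡ 3))) (sym (ι-* 3 (↧ₙ ε₁)))))))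

  ι-p : ι (suc (suc n)) ≡ 1ℚ ℚ.+ (1ℚ ℚ.+ ι n)
  ι-p = trans (ι-suc (suc n)) (cong (1ℚ ℚ.+_) (ι-suc n))

  upper : ∀ k → M ≤ k → β k ℚ.* ι (q + q) ℚ.+ 1ℚ ℚ.≤ ι (suc (suc n) + suc (suc n))
  upper k M≤k = subst₂ ℚ._≤_ (cong (λ z → β k ℚ.* z ℚ.+ 1ℚ) (sym (ι-+ q q)))
    (sym (trans (ι-+ (suc (suc n)) (suc (suc n))) (cong₂ ℚ._+_ ι-p ι-p)))
    (shift-≤ (ℚ.+-mono-≤ (ℚ.+-mono-≤ r≤1+n r≤1+n) (*-monoˡ-≤ (Q ℚ.+ Q) 0≤2Q (c≈ M k ℕ.≤-refl M≤k)))
      (trans (solve 3 (λ n Q cM → let r = Q :* (con (+ 2 ℚ./ 1) :- (con ½ :+ cM)) in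
          con 1ℚ :+ (con 1ℚ :+ n) :+ (con 1ℚ :+ (con 1ℚ :+ n)) :+ (r :+ r :+ (Q :+ Q) :* cM)
          := con 1ℚ :+ (con 1ℚ :+ ((con 1ℚ :+ n) :+ (con 1ℚ :+ n) :+ (Q :+ Q) :* con (+ 3 ℚ./ 2)))) refl (ι n) Q (seq c M))
      (trans (cong (λ z → 1ℚ ℚ.+ (z ℚ.+ ((1ℚ ℚ.+ ι n) ℚ.+ (1ℚ ℚ.+ ι n) ℚ.+ (Q ℚ.+ Q) ℚ.* (+ 3 ℚ./ 2)))) (sym 2qν≡1))
      (solve 4 (λ n Q ck ν →
          con 1ℚ :+ ((Q :+ Q) :* ν :+ ((con 1ℚ :+ n) :+ (con 1ℚ :+ n) :+ (Q :+ Q) :* con (+ 3 ℚ./ 2)))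
          := (con (+ 2 ℚ./ 1) :- (con ½ :+ ck)) :* (Q :+ Q) :+ con 1ℚ :+ ((con 1ℚ :+ n) :+ (con 1ℚ :+ n) :+ (Q :+ Q) :* (ck :+ ν)))
        refl (ι n) Q (seq c k) ν))))
    where
    0≤2Q : 0ℚ ℚ.≤ Q ℚ.+ Q
    0≤2Q = ℚ.+-mono-≤ (0≤ι q) (0≤ι q)

  lower : ∀ k → M ℕ.⊔ M₂ ≤ k → ι (suc (suc (suc n) * 2)) ℚ.≤ (1ℚ ℚ.- seq c k ℚ.+ seq ε k) ℚ.* ι (q * 2) ℚ.+ Q
  lower k M≤k = subst₂ ℚ._≤_
    (sym (trans (ι-suc (suc (suc n) * 2)) (cong (1ℚ ℚ.+_) (trans (ι-* (suc (suc n)) 2) (cong₂ ℚ._*_ ι-p (ι≡ 2))))))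
    (cong (λ z → (1ℚ ℚ.- seq c k ℚ.+ seq ε k) ℚ.* z ℚ.+ Q) (sym (trans (ι-* q 2) (cong (Q ℚ.*_) (ι≡ 2)))))
    (shift-≤ (ℚ.+-mono-≤ (ℚ.+-mono-≤ (ℚ.+-mono-≤ n≤r n≤r) (ℚ.+-mono-≤ 3≤Qε₁ 3≤Qε₁))
        (ℚ.+-mono-≤ (*-monoˡ-≤ (Q ℚ.+ Q) 0≤2Q (c≈ k M (ℕ.m⊔n≤o⇒m≤o M M₂ M≤k) ℕ.≤-refl))
          (*-monoˡ-≤ (Q ℚ.+ Q) 0≤2Q (ℚ.<⇒≤ (subst (ℚ._< seq ε k) (ℚ.+-identityˡ ε₁) (ε> k (ℕ.m⊔n≤o⇒n≤o M M₂ M≤k)))))))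
      (trans (solve 5 (λ n Q ck e e₁ →
          (con 1ℚ :- ck :+ e) :* (Q :* con (+ 2 ℚ./ 1)) :+ Q :+ (n :+ n :+ (con (+ 3 ℚ./ 1) :+ con (+ 3 ℚ./ 1)) :+ ((Q :+ Q) :* ck :+ (Q :+ Q) :* e₁))
          := con 1ℚ :+ (con (+ 5 ℚ./ 1) :+ n :+ n :+ (e :+ e :+ e₁ :+ e₁ :+ con (+ 3 ℚ./ 1)) :* Q)) refl (ι n) Q (seq c k) (seq ε k) ε₁)
      (trans (cong (λ z → z ℚ.+ ((+ 5 ℚ./ 1) ℚ.+ ι n ℚ.+ ι n ℚ.+ (seq ε k ℚ.+ seq ε k ℚ.+ ε₁ ℚ.+ ε₁ ℚ.+ (+ 3 ℚ./ 1)) ℚ.* Q)) (sym 2qν≡1))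
      (solve 6 (λ n Q cM e e₁ ν → let r = Q :* (con (+ 2 ℚ./ 1) :- (con ½ :+ cM)) in
          (Q :+ Q) :* ν :+ (con (+ 5 ℚ./ 1) :+ n :+ n :+ (e :+ e :+ e₁ :+ e₁ :+ con (+ 3 ℚ./ 1)) :* Q)
          := con 1ℚ :+ (con 1ℚ :+ (con 1ℚ :+ n)) :* con (+ 2 ℚ./ 1) :+ (r :+ r :+ (Q :* e₁ :+ Q :* e₁) :+ ((Q :+ Q) :* (cM :+ ν) :+ (Q :+ Q) :* e)))
        refl (ι n) Q (seq c M) (seq ε k) ε₁ ν))))
    where
    0≤2Q : 0ℚ ℚ.≤ Q ℚ.+ Q
    0≤2Q = ℚ.+-mono-≤ (0≤ι q) (0≤ι q)

PL⇒square-difference-free-bound : (c : ℝ) (γ<2 : 0·5ʳ +ʳ c <ʳ fromℕ 2) → PL 2 (0·5ʳ +ʳ c) γ<2 →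
  (ε : ℝ) → 0ʳ <ʳ ε →
  ∃[ N₀ ] ((N : ℕ) .{{_ : NonZero N}} → N₀ ≤ N →
    (A : Subset N) → SquareDifferenceFree ⟦ A ⟧ → fromℕ ∣ A ∣ ≤ʳ N ^ʳ (1ʳ -ʳ c +ʳ ε))
PL⇒square-difference-free-bound c γ<2 pl ε 0<ε =
  let p , q , p≢0 , q≢0 , upper , lower = approximate-exponent c ε γ<2 0<ε
      N₀ , sparse = PL⇒sparse (0·5ʳ +ʳ c) γ<2 pl p q {{p≢0}} {{q≢0}} upper
  in N₀ , λ N N₀≤N A sdf N^<∣A∣ →
     sparse N N₀≤N ∣ A ∣ (λ i → toℕ (members A i)) (members-sdf A sdf) (λ i → ℕ.<⇒≤ (Fin.toℕ<n (members A i)))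
       (power<⇒≤ N (1ʳ -ʳ c +ʳ ε) ∣ A ∣ (suc (p * 2)) (q * 2) q N^<∣A∣ lower)

-- Digit expansions

remainder-unique : ∀ {b a c u v} .{{_ : NonZero b}} → a < b → c < b → a + b * u ≡ c + b * v → a ≡ c × u ≡ v
remainder-unique {b} {a} {c} {u} {v} a<b c<b e = a≡c ,
  ℕ.*-cancelˡ-≡ u v b (ℕ.+-cancelˡ-≡ c (b * u) (b * v) (trans (cong (_+ b * u) (sym a≡c)) e))
  where
  a≡c : a ≡ c
  a≡c = trans (sym (digit a u a<b)) (trans (cong (_% b) e) (digit c v c<b))
    where
    digit : ∀ a u → a < b → (a + b * u) % b ≡ a
    digit a u a<b = trans (cong (λ z → (a + z) % b) (ℕ.*-comm b u)) (trans ([m+kn]%n≡m%n a u b) (m<n⇒m%n≡m a<b))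

append-digit-< : ∀ {b a u n} → a < b → u < n → a + b * u < b * n
append-digit-< {b} {a} {u} {n} a<b u<n = begin-strict
  a + b * u     <⟨ ℕ.+-monoˡ-< (b * u) a<b ⟩
  b + b * u   ≡⟨ sym (ℕ.*-suc b u) ⟩
  b * suc u     ≤⟨ ℕ.*-monoʳ-≤ b u<n ⟩
  b * n         ∎
  where open ℕ.≤-Reasoning

square-% : ∀ c t b .{{_ : NonZero b}} → (c + t * t) % b ≡ (c + (t % b) * (t % b)) % b
square-% c t b = trans (cong (λ z → (c + z * z) % b) (m≡m%n+[m/n]*n t b))
  (trans (cong (_% b) (expand c (t % b) (t / b) b)) ([m+kn]%n≡m%n (c + (t % b) * (t % b)) (t % b * (t / b) + t % b * (t / b) + t / b * (t / b) * b) b))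
  where
  expand : ∀ c r d b → c + (r + d * b) * (r + d * b) ≡ c + r * r + (r * d + r * d + d * d * b) * b
  expand = solve-∀

-- The exponent `k` factors out, and the rest is the square of `h` times m^(4q). The conclusion is
-- the inequality refuted by `PL⇒sparse`, for N = m^(2k), s = (wm)^k and p = q + t.
ruzsa-dense : ∀ m w q t k → m ^ suc (t * 2) ≤ w ^ q →
  ((m * m) ^ k) ^ suc ((q + t) * 2) ≤ ((w * m) ^ k) ^ (q * 2) * ((m * m) ^ k) ^ q
ruzsa-dense m w q t k h = begin
  ((m * m) ^ k) ^ suc ((q + t) * 2)   ≡⟨ swap (m * m) k (suc ((q + t) * 2)) ⟩
  ((m * m) ^ suc ((q + t) * 2)) ^ k                   ≤⟨ ℕ.^-monoˡ-≤ k basis ⟩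
  ((w * m) ^ (q * 2) * (m * m) ^ q) ^ k         ≡⟨ ^-distribʳ-* ((w * m) ^ (q * 2)) ((m * m) ^ q) k ⟩
  ((w * m) ^ (q * 2)) ^ k * ((m * m) ^ q) ^ k   ≡⟨ cong₂ _*_ (swap (w * m) (q * 2) k) (swap (m * m) q k) ⟩
  ((w * m) ^ k) ^ (q * 2) * ((m * m) ^ k) ^ q   ∎
  where
  open ℕ.≤-Reasoning
  swap : ∀ a b c → (a ^ b) ^ c ≡ (a ^ c) ^ b
  swap a b c = trans (ℕ.^-*-assoc a b c) (trans (cong (a ^_) (ℕ.*-comm b c)) (sym (ℕ.^-*-assoc a c b)))
  square : ∀ a e → (a * a) ^ e ≡ a ^ e * a ^ e
  square a e = ^-distribʳ-* a a e
  M = m ^ q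
  T = m ^ suc (t * 2)
  basis : (m * m) ^ suc ((q + t) * 2) ≤ (w * m) ^ (q * 2) * (m * m) ^ q
  basis = begin
    (m * m) ^ suc ((q + t) * 2)   ≡⟨ cong ((m * m) ^_) (exponents q t) ⟩
    (m * m) ^ (suc (t * 2) + (q + q))   ≡⟨ ℕ.^-distribˡ-+-* (m * m) (suc (t * 2)) (q + q) ⟩
    (m * m) ^ suc (t * 2) * (m * m) ^ (q + q)   ≡⟨ cong₂ _*_ (square m (suc (t * 2))) (ℕ.^-distribˡ-+-* (m * m) q q) ⟩
    T * T * ((m * m) ^ q * (m * m) ^ q)  ≤⟨ ℕ.*-monoˡ-≤ ((m * m) ^ q * (m * m) ^ q) (ℕ.*-mono-≤ h h) ⟩
    w ^ q * w ^ q * ((m * m) ^ q * (m * m) ^ q)   ≡⟨ cong (λ z → w ^ q * w ^ q * (z * (m * m) ^ q)) (square m q) ⟩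
    w ^ q * w ^ q * (M * M * (m * m) ^ q)         ≡⟨ shuffle (w ^ q) M ((m * m) ^ q) ⟩
    (w ^ q * M) * (w ^ q * M * 1) * (m * m) ^ q   ≡⟨ cong (λ z → z ^ 2 * (m * m) ^ q) (sym (^-distribʳ-* w m q)) ⟩
    ((w * m) ^ q) ^ 2 * (m * m) ^ q               ≡⟨ cong (_* (m * m) ^ q) (ℕ.^-*-assoc (w * m) q 2) ⟩
    (w * m) ^ (q * 2) * (m * m) ^ q               ∎
    where
    exponents : ∀ q t → 1 + (q + t) * 2 ≡ 1 + t * 2 + (q + q)
    exponents = solve-∀
    shuffle : ∀ a b c → a * a * (b * b * c) ≡ (a * b) * (a * b * 1) * c
    shuffle = solve-∀

n<b^n : ∀ b n → 2 ≤ b → n < b ^ n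
n<b^n b zero    2≤b = s≤s z≤n
n<b^n b (suc n) 2≤b = begin-strict
  suc n                ≤⟨ n<b^n b n 2≤b ⟩
  b ^ n                <⟨ ℕ.m<m+n (b ^ n) (ℕ.≤-<-trans z≤n (n<b^n b n 2≤b)) ⟩
  b ^ n + b ^ n   ≡⟨ cong (λ z → b ^ n + z) (sym (ℕ.+-identityʳ (b ^ n))) ⟩
  2 * b ^ n            ≤⟨ ℕ.*-monoˡ-≤ (b ^ n) 2≤b ⟩
  b * b ^ n            ∎
  where open ℕ.≤-Reasoning

-- Ruzsa's construction: base-m expansions whose even digits are residues and whose
-- odd digits are arbitrary.
module Ruzsa (m w : ℕ) .{{_ : NonZero m}} (residue : Fin w → ℕ) (residue<m : ∀ r → residue r < m)
  (residue-sdf : ∀ r r′ (τ : Fin m) → residue r ≡ (residue r′ + toℕ τ * toℕ τ) % m → r ≡ r′)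
  (squarefree : ∀ (τ : Fin m) → (toℕ τ * toℕ τ) % m ≡ 0 → toℕ τ ≡ 0) where

  reduce : ℕ → Fin m
  reduce t = fromℕ< (m%n<n t m)

  toℕ-reduce : ∀ t → toℕ (reduce t) ≡ t % m
  toℕ-reduce t = Fin.toℕ-fromℕ< (m%n<n t m)

  -- Modulo `m` the residues differ by a square, hence agree. Then m divides t², so by `squarefree`
  -- it divides t, and t² is divisible by m². Cancelling one `m` leaves a multiple of `m`, invisible
  -- to the next digit.
  residues-step : ∀ r r′ u v t → residue r + m * u ≡ residue r′ + m * v + t * t →
    r ≡ r′ × ∃[ t′ ] u ≡ v + m * (t′ * t′)
  residues-step r r′ u v t e = r≡r′ , t / m , ℕ.*-cancelˡ-≡ u _ m m*u≡
    where
    τ = reduce t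
    r≡r′ : r ≡ r′
    r≡r′ = residue-sdf r r′ τ (begin
      residue r                              ≡⟨ sym (m<n⇒m%n≡m (residue<m r)) ⟩
      residue r % m                          ≡⟨ sym ([m+kn]%n≡m%n (residue r) u m) ⟩
      (residue r + u * m) % m                ≡⟨ cong (λ z → (residue r + z) % m) (ℕ.*-comm u m) ⟩
      (residue r + m * u) % m                ≡⟨ cong (_% m) (trans e (shuffle (residue r′) v (t * t) m)) ⟩
      (residue r′ + t * t + v * m) % m       ≡⟨ [m+kn]%n≡m%n (residue r′ + t * t) v m ⟩
      (residue r′ + t * t) % m               ≡⟨ square-% (residue r′) t m ⟩
      (residue r′ + (t % m) * (t % m)) % m   ≡⟨ cong (λ z → (residue r′ + z * z) % m) (sym (toℕ-reduce t)) ⟩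
      (residue r′ + toℕ τ * toℕ τ) % m       ∎)
      where
      open ≡-Reasoning
      shuffle : ∀ a v s b → a + b * v + s ≡ a + s + v * b
      shuffle = solve-∀
    m*u≡m*v+t² : m * u ≡ m * v + t * t
    m*u≡m*v+t² = ℕ.+-cancelˡ-≡ (residue r′) _ _
      (trans (cong (λ z → residue z + m * u) (sym r≡r′)) (trans e (ℕ.+-assoc (residue r′) (m * v) (t * t))))
    t%m≡0 : t % m ≡ 0
    t%m≡0 = trans (sym (toℕ-reduce t)) (squarefree τ (begin
      (toℕ τ * toℕ τ) % m       ≡⟨ cong (λ z → (z * z) % m) (toℕ-reduce t) ⟩
      ((t % m) * (t % m)) % m   ≡⟨ sym (square-% 0 t m) ⟩
      (t * t) % m               ≡⟨ sym ([m+kn]%n≡m%n (t * t) v m) ⟩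
      (t * t + v * m) % m       ≡⟨ cong (_% m) (trans (shuffle v (t * t) m) (sym m*u≡m*v+t²)) ⟩
      (m * u) % m               ≡⟨ cong (_% m) (ℕ.*-comm m u) ⟩
      (u * m) % m               ≡⟨ m*n%n≡0 u m ⟩
      0                         ∎))
      where
      open ≡-Reasoning
      shuffle : ∀ v s b → s + v * b ≡ b * v + s
      shuffle = solve-∀
    m*u≡ : m * u ≡ m * (v + m * ((t / m) * (t / m)))
    m*u≡ = trans m*u≡m*v+t² (trans
      (cong (λ z → m * v + z * z) (trans (m≡m%n+[m/n]*n t m) (cong (_+ t / m * m) t%m≡0)))
      (expand v (t / m) m))
      where
      expand : ∀ v d b → b * v + d * b * (d * b) ≡ b * (v + b * (d * d))
      expand = solve-∀

  ruzsaSize : ℕ → ℕ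
  ruzsaSize zero    = 1
  ruzsaSize (suc k) = w * (m * ruzsaSize k)

  ruzsa : ∀ k → Fin (ruzsaSize k) → ℕ
  ruzsa zero    _ = 0
  ruzsa (suc k) i =
    let r , i′ = remQuot {w} (m * ruzsaSize k) i
        d , i″ = remQuot {m} (ruzsaSize k) i′
    in residue r + m * (toℕ d + m * ruzsa k i″)

  -- Digits are removed in pairs. `residues-step` settles the residue digit and leaves m t′² as the
  -- difference of the rest; the free digits then agree modulo `m`, and what remains differs by the
  -- square t′².
  ruzsa-sdf : ∀ k → SquareDifferenceFreeSeq (ruzsa k)
  ruzsa-sdf zero    zero zero t e = refl
  ruzsa-sdf (suc k) i j t e =
    let r , i′ = remQuot {w} (m * ruzsaSize k) i
        d , i″ = remQuot {m} (ruzsaSize k) i′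
        s , j′ = remQuot {w} (m * ruzsaSize k) j
        f , j″ = remQuot {m} (ruzsaSize k) j′
        r≡s , t′ , e′ = residues-step r s (toℕ d + m * ruzsa k i″) (toℕ f + m * ruzsa k j″) t e
        d≡f , e″ = remainder-unique (Fin.toℕ<n d) (Fin.toℕ<n f) (trans e′ (shuffle (toℕ f) (ruzsa k j″) (t′ * t′) m))
        i″≡j″ = ruzsa-sdf k i″ j″ t′ e″
    in remQuot-injective w (m * ruzsaSize k) i j (cong₂ _,_ r≡s
         (remQuot-injective m (ruzsaSize k) i′ j′ (cong₂ _,_ (Fin.toℕ-injective d≡f) i″≡j″)))
    where
    shuffle : ∀ f v s b → f + b * v + b * s ≡ f + b * (v + s)
    shuffle = solve-∀
    remQuot-injective : ∀ a n (i j : Fin (a * n)) → remQuot {a} n i ≡ remQuot n j → i ≡ j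
    remQuot-injective a n i j e = trans (sym (Fin.combine-remQuot {a} n i))
      (trans (cong (λ z → combine (proj₁ z) (proj₂ z)) e) (Fin.combine-remQuot {a} n j))

  ruzsa-< : ∀ k i → ruzsa k i < (m * m) ^ k
  ruzsa-< zero    i = s≤s z≤n
  ruzsa-< (suc k) i =
    let r , i′ = remQuot {w} (m * ruzsaSize k) i
        d , i″ = remQuot {m} (ruzsaSize k) i′
    in ℕ.<-≤-trans (append-digit-< {m} (residue<m r) (append-digit-< {m} (Fin.toℕ<n d) (ruzsa-< k i″)))
         (ℕ.≤-reflexive (sym (ℕ.*-assoc m m ((m * m) ^ k))))

  ruzsaSize≡ : ∀ k → ruzsaSize k ≡ (w * m) ^ k
  ruzsaSize≡ zero    = refl
  ruzsaSize≡ (suc k) = trans (cong (λ z → w * (m * z)) (ruzsaSize≡ k)) (sym (ℕ.*-assoc w m ((w * m) ^ k)))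

  -- The fraction b / a bounds log w / log m from below. With p = q + t, (2p - 1) / 2q = 1 + b / 2a
  -- - 1 / (aj), so a large `j` makes the loss from rounding negligible.
  ruzsa⇒¬PL : ∀ γ γ<2 a b j t → 2 ≤ m → .{{_ : NonZero a}} .{{_ : NonZero j}} → let q = a * j in
    m ^ b ≤ w ^ a → suc (t * 2) ≡ b * j →
    (∀ k → seq (fromℕ 2 -ʳ γ) k ℚ.* ι (q + q) ℚ.+ 1ℚ ℚ.≤ ι ((q + t) + (q + t))) →
    ¬ PL 2 γ γ<2
  ruzsa⇒¬PL γ γ<2 a b j t 2≤m m^b≤w^a 2t+1≡bj β≤ pl = proj₂ sparse N N₀≤N (ruzsaSize N₀) (ruzsa N₀) (ruzsa-sdf N₀)
    (λ i → ℕ.<⇒≤ (ruzsa-< N₀ i))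
    (subst (λ s → N ^ suc ((q + t) * 2) ≤ s ^ (q * 2) * N ^ q) (sym (ruzsaSize≡ N₀)) (ruzsa-dense m w q t N₀ dense))
    where
    q = a * j
    instance
      q≢0 : NonZero q
      q≢0 = ℕ.m*n≢0 a j
      p≢0 : NonZero (q + t)
      p≢0 = ℕ.>-nonZero (ℕ.≤-trans (ℕ.>-nonZero⁻¹ q) (ℕ.m≤m+n q t))
    sparse = PL⇒sparse γ γ<2 pl (q + t) q (0 , λ k _ → β≤ k)
    N₀ = proj₁ sparse
    N = (m * m) ^ N₀
    instance
      N≢0 : NonZero N
      N≢0 = ℕ.m^n≢0 (m * m) N₀ {{ℕ.m*n≢0 m m}}
    -- The threshold itself serves as the number of digit pairs, because (m²)^N₀ exceeds N₀.
    N₀≤N : N₀ ≤ N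
    N₀≤N = ℕ.<⇒≤ (n<b^n (m * m) N₀ (ℕ.≤-trans 2≤m (ℕ.m≤m*n m m)))
    dense : m ^ suc (t * 2) ≤ w ^ q
    dense = begin
      m ^ suc (t * 2)   ≡⟨ cong (m ^_) 2t+1≡bj ⟩
      m ^ (b * j)   ≡⟨ sym (ℕ.^-*-assoc m b j) ⟩
      (m ^ b) ^ j          ≤⟨ ℕ.^-monoˡ-≤ j m^b≤w^a ⟩
      (w ^ a) ^ j   ≡⟨ ℕ.^-*-assoc w a j ⟩
      w ^ (a * j)   ∎
      where open ℕ.≤-Reasoning

-- The Beigel–Gasarch residues.
residue : Fin 12 → ℕ
residue = 0 ∷ 2 ∷ 8 ∷ 14 ∷ 77 ∷ 79 ∷ 85 ∷ 96 ∷ 103 ∷ 109 ∷ 111 ∷ 181 ∷ []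

residue<205 : ∀ r → residue r < 205
residue<205 = from-yes (Fin.all? (λ r → residue r ℕ.<? 205))

residue-sdf-205 : ∀ r r′ (τ : Fin 205) → residue r ≡ (residue r′ + toℕ τ * toℕ τ) % 205 → r ≡ r′
residue-sdf-205 = from-yes (Fin.all? λ r → Fin.all? λ r′ → Fin.all? λ (τ : Fin 205) →
  (residue r ℕ.≟ (residue r′ + toℕ τ * toℕ τ) % 205) →-dec (r Fin.≟ r′))

-- It holds because 205 = 5 · 41 has no repeated prime factor.
squarefree-205 : ∀ (τ : Fin 205) → (toℕ τ * toℕ τ) % 205 ≡ 0 → toℕ τ ≡ 0
squarefree-205 = from-yes (Fin.all? λ (τ : Fin 205) → ((toℕ τ * toℕ τ) % 205 ℕ.≟ 0) →-dec (toℕ τ ℕ.≟ 0))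

-- A certificate for 211 / 452 ≤ log 12 / log 205. Its margin 211 - 0.4668 · 452 = 0.0064 must reach
-- 2 after scaling, and 313 is the least factor that achieves this. Both 211 and 313 must be odd, as
-- their product is 2t + 1.
205^211≤12^452 : 205 ^ 211 ≤ 12 ^ 452
205^211≤12^452 = ℕ.≤ᵇ⇒≤ (205 ^ 211) (12 ^ 452) _

-- With q = 452 * 313 and t = (211 * 313 - 1) / 2, the fraction (2 (q + t) - 1) / 2q lies
-- slightly above 2 - 0.7666: indeed 211 / 452 > 0.4668, and log 12 / log 205 = 0.46682….
¬PL-0·7666 : ¬ PL 2 0·7666ʳ 0·7666<2
¬PL-0·7666 = Ruzsa.ruzsa⇒¬PL 205 12 residue residue<205 residue-sdf-205 squarefree-205
  0·7666ʳ 0·7666<2 452 211 313 33021 (s≤s (s≤s z≤n)) 205^211≤12^452 refl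
  λ k → subst₂ (λ x y → 1·2334 ℚ.* x ℚ.+ 1ℚ ℚ.≤ y) (sym (ι≡ 282952)) (sym (ι≡ 348994))
    (from-yes (1·2334 ℚ.* (+ 282952 ℚ./ 1) ℚ.+ 1ℚ ℚ.≤? (+ 348994 ℚ./ 1)))
  where
  1·2334 : ℚ
  1·2334 = + 2 ℚ./ 1 ℚ.- (+ 7666 ℚ./ 10000)

corollary1p16 : ¬ PL 2 0·7666ʳ 0·7666<2
    ×
    ((c : ℝ) → 0ʳ <ʳ c → (γ<2 : 0·5ʳ +ʳ c <ʳ fromℕ 2) →
    PL 2 (0·5ʳ +ʳ c) γ<2 →
    (ε : ℝ) → 0ʳ <ʳ ε →
    ∃[ N₀ ] ((N : ℕ) .{{_ : NonZero N}} → N₀ ≤ N →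
    (A : Subset N) → SquareDifferenceFree ⟦ A ⟧ →
    fromℕ ∣ A ∣ ≤ʳ N ^ʳ (1ʳ -ʳ c +ʳ ε)))
corollary1p16 = ¬PL-0·7666 , λ c _ → PL⇒square-difference-free-bound c
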